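{- For every finite configuration $F\subseteq \mathbb{Z}^d$ of $|F|=k\geq 3$ points and every real $\mu\in (0,\frac{k-1}{k})$ there is a set of lattice points $X=X(F,\mu)\subseteq \mathbb{N}^d$ such that (i) for every integer $r\geq 1$, every $r$-colouring of $X$ contains a monochromatic homothetic copy of $F$, and (ii) every finite subset $Y\subseteq X$ has an $F$-free subset $Z\subseteq Y$ of size $|Z|\geq \mu|Y|$.
   Context: A homothetic copy of $F\subseteq\mathbb{Z}^d$ is a set of the form $v+\lambda F=\{v+\lambda f\colon f\in F\}$ with $v\in\mathbb{Z}^d$ and $\lambda$ a positive integer. A set $Z\subseteq\mathbb{Z}^d$ is called $F$-free if there is no nonzero real number $\lambda$ such that $Z$ contains a subset congruent (i.e., isometric in the Euclidean metric of $\mathbb{R}^d$) to $\lambda F=\{\lambda f\colon f\in F\}$. -}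

module Defs where

open import Data.Nat as ℕ using (ℕ; zero; suc)
open import Data.Integer as ℤ using (ℤ; +_)
open import Data.Fin using (Fin)
open import Data.Vec using (Vec; zipWith; map; foldr)
open import Data.Vec.Relation.Unary.All as VAll using ()
open import Data.List using (List; length)
open import Data.List.Membership.Propositional using (_∈_)
open import Data.List.Relation.Unary.Unique.Propositional using (Unique)
open import Data.Rational as ℚ using (ℚ; _/_)
open import Data.Product using (Σ; ∃; _×_; _,_)
open import Function.Definitions using (Injective)
open import Relation.Binary.PropositionalEquality using (_≡_)
open import Relation.Nullary using (¬_)

Point : ℕ → Set
Point d = Vec ℤ d

_⊕_ : ∀ {d} → Point d → Point d → Point d
_⊕_ = zipWith ℤ._+_

_⊖_ : ∀ {d} → Point d → Point d → Point d
_⊖_ = zipWith ℤ._-_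

_⊙_ : ∀ {d} → ℤ → Point d → Point d
l ⊙ x = map (l ℤ.*_) x

‖_‖² : ∀ {d} → Point d → ℤ
‖ x ‖² = foldr _ ℤ._+_ (+ 0) (map (λ a → a ℤ.* a) x)

Config : ℕ → ℕ → Set
Config d k = Σ (Fin k → Point d) (λ F → Injective _≡_ _≡_ F)

InNat : ∀ {d} → (Point d → Set) → Set
InNat {d} X = ∀ x → X x → VAll.All (ℤ._≤_ (+ 0)) x

Colouring : ∀ {d} → (Point d → Set) → ℕ → Set
Colouring {d} X r = (x : Point d) → X x → Fin r

MonoHomothetic : ∀ {d k r} (F : Config d k) (X : Point d → Set) → Colouring X r → Set
MonoHomothetic {d} {k} {r} (F , _) X c =
  Σ (Point d) λ v → Σ ℕ λ l → (1 ℕ.≤ l) ×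
    Σ ((i : Fin k) → X (v ⊕ ((+ l) ⊙ F i))) λ mem →
      Σ (Fin r) λ col → ∀ i → c (v ⊕ ((+ l) ⊙ F i)) (mem i) ≡ col

-- Z (a finite set of points) contains a subset congruent to λF for some real λ ≠ 0.
-- Such a subset is the image of a map φ : F → Z with ‖φf − φg‖² = λ² ‖f − g‖²;
-- λ² = p/q is then necessarily a positive rational (F has ≥ 2 points), so we
-- quantify over positive naturals p, q.
ContainsCongruentDilate : ∀ {d k} → Config d k → List (Point d) → Set
ContainsCongruentDilate {d} {k} (F , _) Z =
  Σ (Fin k → Point d) λ φ → (∀ i → φ i ∈ Z) ×
    Σ ℕ λ p → Σ ℕ λ q → (1 ℕ.≤ p) × (1 ℕ.≤ q) ×
      (∀ i j → (+ q) ℤ.* ‖ φ i ⊖ φ j ‖² ≡ (+ p) ℤ.* ‖ F i ⊖ F j ‖²)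

FFree : ∀ {d k} → Config d k → List (Point d) → Set
FFree F Z = ¬ ContainsCongruentDilate F Z

-- Z ⊆ Y for finite sets represented as duplicate-free lists
_⊆ˡ_ : ∀ {d} → List (Point d) → List (Point d) → Set
Z ⊆ˡ Y = ∀ {x} → x ∈ Z → x ∈ Y

FiniteSubsetOf : ∀ {d} → List (Point d) → (Point d → Set) → Set
FiniteSubsetOf Y X = Unique Y × (∀ {x} → x ∈ Y → X x)

ℕtoℚ : ℕ → ℚ
ℕtoℚ n = + n / 1

predOver : ℕ → ℚ
predOver zero = ℚ.0ℚ
predOver (suc n) = + n / suc n

{-# OPTIONS --safe #-}
module Submission where

-- Proof idea. The vertices of the shift hypergraph are the decreasing m-tuples of naturals, its
-- edges the k consecutive windows of decreasing (m + k − 1)-tuples. Its chromatic number is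
-- infinite. But mark the naturals independently with a small probability, and keep a vertex if its
-- first marked entry exists and its position (counted from 0) is not divisible by k: no edge is kept
-- completely, as the position drops by one from window to window, and each vertex is kept with
-- probability close to (k − 1) / k.
-- A partite construction transfers this to ℤ^d: starting from well separated copies of F,
-- one for every edge, the points labelled by one vertex v after another are amalgamated with the
-- Hales–Jewett theorem, words over the alphabet of v-labelled points being realised as sums
-- with rapidly growing weights. The growth forces each congruent copy of a dilate of F to be
-- blockwise constant or such a copy. To conclude that its labels form an edge
-- one needs a family of Hales–Jewett lines among whose active sets no k cover every
-- point of their union exactly k − 1 times (k ≥ 3); it is obtained by appending to Λ^N a further
-- block for each line ℓ of Λ^N, and gluing to ℓ only lines that are active in the block of ℓ.

open import Defs
open import Data.Nat as ℕ using (ℕ; zero; suc; _≤_; _<_; _+_; _*_; _^_; z≤n; s≤s)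
import Data.Nat.Properties as ℕP
import Data.Nat.Tactic.RingSolver as ℕSolver
open import Data.Integer as ℤ using (ℤ; +_; ∣_∣)
import Data.Integer.Properties as ℤP
import Data.Integer.Tactic.RingSolver as ℤSolver
open import Data.Rational as ℚ using (ℚ)
import Data.Rational.Properties as ℚP
open import Data.Rational.Unnormalised as ℚᵘ using (mkℚᵘ)
import Data.Rational.Unnormalised.Properties as ℚᵘP
open import Data.Bool using (Bool; true; false; if_then_else_; not)
import Data.Bool.Properties as BoolP
open import Data.Fin as Fin using (Fin; zero; suc)
import Data.Fin.Properties as FinP
open import Data.Unit using (⊤; tt)
open import Data.Empty using (⊥)
open import Data.Maybe using (Maybe; just; nothing; fromMaybe)
import Data.Maybe.Relation.Unary.All as MAll
open import Data.Product using (Σ; ∃; _×_; _,_; proj₁; proj₂)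
import Data.Product.Properties as ProductP
open import Data.Sum using (_⊎_; inj₁; inj₂)
open import Data.List as List using (List; []; _∷_; length)
import Data.List.Properties as ListP
open import Data.List.Membership.Propositional using (_∈_)
open import Data.List.Membership.Propositional.Properties
import Data.List.Membership.DecPropositional as DecMembership
open import Data.List.Relation.Unary.All as LAll using ([]; _∷_)
import Data.List.Relation.Unary.All.Properties as LAllP
open import Data.List.Relation.Unary.AllPairs using ([]; _∷_)
import Data.List.Relation.Unary.AllPairs.Properties as AllPairsP
open import Data.List.Relation.Unary.Any using (here; there; index; any?)
open import Data.List.Relation.Unary.Any.Properties using (lookup-index)
open import Data.List.Relation.Unary.Unique.Propositional using (Unique)
open import Data.Vec as Vec using (Vec; []; _∷_)
import Data.Vec.Properties as VecP
open import Data.Vec.Relation.Unary.All as VAll using ([]; _∷_)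
import Data.Vec.Relation.Unary.All.Properties as VAllP
open import Function.Base using (_∘_)
open import Relation.Binary.PropositionalEquality
open import Relation.Nullary using (¬_; Dec; yes; no; contradiction)
open import Relation.Nullary.Decidable using (_×-dec_)

private variable
  A B : Set
  d m n : ℕ

-- Hales–Jewett

words : List A → (n : ℕ) → List (Vec A n)
words Λ zero = [] ∷ []
words Λ (suc n) = List.cartesianProductWith _∷_ Λ (words Λ n)

∈-words⁺ : ∀ {Λ : List A} {w : Vec A n} → VAll.All (_∈ Λ) w → w ∈ words Λ n
∈-words⁺ [] = here refl
∈-words⁺ (a∈ ∷ w∈) = ∈-cartesianProductWith⁺ _∷_ a∈ (∈-words⁺ w∈)

∈-words⁻ : ∀ {Λ : List A} {w : Vec A n} → w ∈ words Λ n → VAll.All (_∈ Λ) w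
∈-words⁻ {w = []} _ = []
∈-words⁻ {n = suc n} {Λ = Λ} {w = _ ∷ _} w∈
  with _ , _ , a∈ , v∈ , refl ← ∈-cartesianProductWith⁻ _∷_ Λ (words Λ n) w∈ = a∈ ∷ ∈-words⁻ v∈

-- A combinatorial line is given by a word in which nothing marks the active positions.
Template : Set → ℕ → Set
Template A n = Vec (Maybe A) n

fill : Template A n → A → Vec A n
fill t a = Vec.map (fromMaybe a) t

constant : Vec A n → Template A n
constant = Vec.map just

fill-constant : (w : Vec A n) (a : A) → fill (constant w) a ≡ w
fill-constant w a = trans (sym (VecP.map-∘ _ _ w)) (VecP.map-id w)

FixedIn : List A → Template A n → Set
FixedIn Λ t = VAll.All (MAll.All (_∈ Λ)) t

constant-fixedIn : ∀ {Λ : List A} {w : Vec A n} → VAll.All (_∈ Λ) w → FixedIn Λ (constant w)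
constant-fixedIn w∈ = VAllP.map⁺ (VAll.map MAll.just w∈)

fill-∈ : ∀ {Λ : List A} {t : Template A n} {a} → FixedIn Λ t → a ∈ Λ → VAll.All (_∈ Λ) (fill t a)
fill-∈ [] a∈ = []
fill-∈ (MAll.just b∈ ∷ t∈) a∈ = b∈ ∷ fill-∈ t∈ a∈
fill-∈ (MAll.nothing ∷ t∈) a∈ = a∈ ∷ fill-∈ t∈ a∈

Active : Template A n → Fin n → Set
Active t i = Vec.lookup t i ≡ nothing

IsLine : List A → Template A n → Set
IsLine Λ t = FixedIn Λ t × ∃ (Active t)

++-lineˡ : ∀ {Λ : List A} {t : Template A m} {u : Template A n} →
  IsLine Λ t → FixedIn Λ u → IsLine Λ (t Vec.++ u)
++-lineˡ {t = t} {u} (t∈ , i , act) u∈ =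
  VAllP.++⁺ t∈ u∈ , i Fin.↑ˡ _ , trans (VecP.lookup-++ˡ t u i) act

++-lineʳ : ∀ {Λ : List A} {t : Template A m} {u : Template A n} →
  FixedIn Λ t → IsLine Λ u → IsLine Λ (t Vec.++ u)
++-lineʳ {t = t} {u} t∈ (u∈ , i , act) =
  VAllP.++⁺ t∈ u∈ , _ Fin.↑ʳ i , trans (VecP.lookup-++ʳ t u i) act

weaken-fixedIn : ∀ {Λ : List A} {a} {t : Template A n} → FixedIn Λ t → FixedIn (a ∷ Λ) t
weaken-fixedIn = VAll.map (MAll.map there)

MonoOn : List A → Template A n → (Vec A n → B) → Set
MonoOn Λ t c = ∀ {a b} → a ∈ Λ → b ∈ Λ → c (fill t a) ≡ c (fill t b)

HalesJewett : List A → Set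
HalesJewett Λ = ∀ r → Σ ℕ λ n → (c : Vec _ n → Fin r) →
  Σ (Template _ n) λ t → IsLine Λ t × MonoOn Λ t c

-- Hales-Jewett is applied to the product of the colourings `c b` for b in `bs`, coded in
-- `Fin (r ^ length bs)`.
HalesJewett-family : ∀ {Λ : List A} → HalesJewett Λ → (bs : List B) (r : ℕ) →
  Σ ℕ λ n → (c : B → Vec A n → Fin r) →
    Σ (Template A n) λ t → IsLine Λ t × (∀ {b} → b ∈ bs → MonoOn Λ t (c b))
HalesJewett-family {A = A} {B = B} {Λ} hj bs r = dim , line
  where
  dim = proj₁ (hj (r ^ length bs))
  line : (c : B → Vec A dim → Fin r) → _
  line c with t , t-line , mono ← proj₂ (hj (r ^ length bs)) (λ w → Fin.funToFin (λ i → c (List.lookup bs i) w)) =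
    t , t-line , λ {b} b∈ {x} {y} x∈ y∈ → begin
      c b (fill t x)                                  ≡⟨ decode b∈ (fill t x) ⟨
      Fin.finToFun (Fin.funToFin (col (fill t x))) (index b∈) ≡⟨ cong (λ z → Fin.finToFun z (index b∈)) (mono x∈ y∈) ⟩
      Fin.finToFun (Fin.funToFin (col (fill t y))) (index b∈) ≡⟨ decode b∈ (fill t y) ⟩
      c b (fill t y)                                  ∎
    where
    open ≡-Reasoning
    col : Vec A dim → Fin (length bs) → Fin r
    col w i = c (List.lookup bs i) w
    decode : ∀ {b} (b∈ : b ∈ bs) w → Fin.finToFun (Fin.funToFin (col w)) (index b∈) ≡ c b w
    decode b∈ w = trans (FinP.finToFun-funToFin (col w) (index b∈)) (cong (λ b → c b w) (sym (lookup-index b∈)))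

unique-lookup-injective : ∀ {xs : List A} → Unique xs → ∀ i j → List.lookup xs i ≡ List.lookup xs j → i ≡ j
unique-lookup-injective (_ ∷ _) zero zero _ = refl
unique-lookup-injective {xs = _ ∷ xs} (x∉ ∷ _) zero (suc j) eq = contradiction eq (LAll.lookup x∉ (∈-lookup {xs = xs} j))
unique-lookup-injective {xs = _ ∷ xs} (x∉ ∷ _) (suc i) zero eq = contradiction (sym eq) (LAll.lookup x∉ (∈-lookup {xs = xs} i))
unique-lookup-injective (_ ∷ u) (suc i) (suc j) eq = cong suc (unique-lookup-injective u i j eq)

unique-length≤ : ∀ {r} {xs : List (Fin r)} → Unique xs → length xs ≤ r
unique-length≤ {xs = xs} u = FinP.injective⇒≤ {f = List.lookup xs} (λ {i} {j} → unique-lookup-injective u i j)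

-- Colour focusing: enlarging the alphabet by one letter.

module _ {A : Set} (a q : A) (Λ′ : List A) (hj : HalesJewett (q ∷ Λ′)) (r : ℕ) where
  private
    Λ = q ∷ Λ′

  FocusedLine : (Vec A n → Fin r) → Vec A n → Fin r → Set
  FocusedLine c f j = Σ (Template A _) λ t → IsLine (a ∷ Λ) t × fill t a ≡ f ×
    (∀ {x} → x ∈ Λ → c (fill t x) ≡ j)

  Focused : (Vec A n → Fin r) → ℕ → Set
  Focused {n} c s = Σ (Vec A n) λ f → VAll.All (_∈ (a ∷ Λ)) f × Σ (List (Fin r)) λ cols →
    Unique cols × length cols ≡ s × LAll.All (FocusedLine c f) cols

  -- The dimension `dim` for s lines comes first. Then l is so large that one line t of the first
  -- block is monochromatic over Λ for every word over `a ∷ Λ` in the second block at once. The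
  -- second block is thus coloured by `c′`, to which the induction hypothesis applies.
  focusing : (s : ℕ) → Σ ℕ λ n → (c : Vec A n → Fin r) →
    (Σ (Template A n) λ t → IsLine (a ∷ Λ) t × MonoOn (a ∷ Λ) t c) ⊎ Focused c s
  focusing zero = 0 , λ c → inj₂ ([] , [] , [] , [] , refl , [])
  focusing (suc s) = l + dim , step
    where
    dim = proj₁ (focusing s)
    step′ = HalesJewett-family hj (words (a ∷ Λ) dim) r
    l = proj₁ step′
    module _ (c : Vec A (l + dim) → Fin r) where
      chosen = proj₂ step′ (λ w x → c (x Vec.++ w))
      t = proj₁ chosen
      t∈ : FixedIn (a ∷ Λ) t
      t∈ = weaken-fixedIn (proj₁ (proj₁ (proj₂ chosen)))
      t-line : IsLine (a ∷ Λ) t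
      t-line = t∈ , proj₂ (proj₁ (proj₂ chosen))
      c′ : Vec A dim → Fin r
      c′ w = c (fill t q Vec.++ w)
      mono : ∀ {x w} → x ∈ Λ → VAll.All (_∈ (a ∷ Λ)) w → c (fill t x Vec.++ w) ≡ c′ w
      mono x∈ w∈ = proj₂ (proj₂ chosen) (∈-words⁺ w∈) x∈ (here refl)
      base-line : ∀ {u : Template A dim} → IsLine (a ∷ Λ) u → IsLine (a ∷ Λ) (constant (fill t q) Vec.++ u)
      base-line = ++-lineʳ (constant-fixedIn (fill-∈ t∈ (there (here refl))))
      base-fill : (u : Template A dim) (x : A) → fill (constant (fill t q) Vec.++ u) x ≡ fill t q Vec.++ fill u x
      base-fill u x = trans (VecP.map-++ _ (constant (fill t q)) u) (cong (Vec._++ fill u x) (fill-constant (fill t q) x))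
      step : (Σ (Template A (l + dim)) λ u → IsLine (a ∷ Λ) u × MonoOn (a ∷ Λ) u c) ⊎ Focused c (suc s)
      step with proj₂ (focusing s) c′
      ... | inj₁ (u , u-line , u-mono) = inj₁ (_ , base-line u-line , λ {x} {y} x∈ y∈ →
              trans (cong c (base-fill u x)) (trans (u-mono x∈ y∈) (cong c (sym (base-fill u y)))))
      ... | inj₂ (f , f∈ , cols , uniq , len , lines) with any? (c′ f FinP.≟_) cols
      -- The focus repeats the colour of one of the lines, which is thereby monochromatic at a as
      -- well.
      ...   | yes hit with u , u-line , u-focus , u-col ← LAll.lookup lines hit =
              inj₁ (_ , base-line u-line , λ {x} {y} x∈ y∈ → trans (value x x∈) (sym (value y y∈)))
        where
        value : ∀ x → x ∈ a ∷ Λ → c (fill (constant (fill t q) Vec.++ u) x) ≡ c′ f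
        value x (here refl) = cong c (trans (base-fill u x) (cong (fill t q Vec.++_) u-focus))
        value x (there x∈) = trans (cong c (base-fill u x)) (u-col x∈)
      -- Advancing t together with each old line keeps the old colours and a common focus; t with f
      -- held fixed brings the new colour `c′ f`.
      ...   | no miss = inj₂ (fill t a Vec.++ f , VAllP.++⁺ (fill-∈ t∈ (here refl)) f∈ ,
              c′ f ∷ cols , LAllP.¬Any⇒All¬ cols miss ∷ uniq , cong suc len ,
              (_ , ++-lineˡ t-line (constant-fixedIn f∈) , new-fill a ,
                λ {x} x∈ → trans (cong c (new-fill x)) (mono x∈ f∈)) ∷ LAll.map extend lines)
        where
        new-fill : ∀ x → fill (t Vec.++ constant f) x ≡ fill t x Vec.++ f
        new-fill x = trans (VecP.map-++ _ t (constant f)) (cong (fill t x Vec.++_) (fill-constant f x))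
        extend : ∀ {j} → FocusedLine c′ f j → FocusedLine c (fill t a Vec.++ f) j
        extend (u , u-line , u-focus , u-col) = t Vec.++ u , ++-lineˡ t-line (proj₁ u-line) ,
          trans (VecP.map-++ _ t u) (cong (fill t a Vec.++_) u-focus) ,
          λ {x} x∈ → trans (cong c (VecP.map-++ _ t u)) (trans (mono x∈ (fill-∈ (proj₁ u-line) (there x∈))) (u-col x∈))

-- The focused lines have distinct colours, so there cannot be r + 1 of them.
hales-jewett-step : ∀ a q (Λ : List A) → HalesJewett (q ∷ Λ) → HalesJewett (a ∷ q ∷ Λ)
hales-jewett-step {A} a q Λ hj r = dim , line
  where
  focus = focusing a q Λ hj r (suc r)
  dim = proj₁ focus
  line : (c : Vec A dim → Fin r) → _
  line c with proj₂ focus c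
  ... | inj₁ mono = mono
  ... | inj₂ (_ , _ , cols , uniq , len , _) = contradiction (subst (_≤ r) len (unique-length≤ uniq)) ℕP.1+n≰n

-- The recursion stops at one letter, since focusing needs an old letter q for the active positions.
hales-jewett : (Λ : List A) → HalesJewett Λ
hales-jewett [] r = 1 , λ c → nothing ∷ [] , (MAll.nothing ∷ [] , zero , refl) , λ ()
hales-jewett (a ∷ []) r = 1 , λ c → nothing ∷ [] , (MAll.nothing ∷ [] , zero , refl) ,
  λ { (here refl) (here refl) → refl }
hales-jewett (a ∷ q ∷ Λ) = hales-jewett-step a q Λ (hales-jewett (q ∷ Λ))

-- Hales–Jewett lines without almost-covers

nothing? : (x : Maybe A) → Dec (x ≡ nothing)
nothing? nothing = yes refl
nothing? (just _) = no λ ()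

active? : (t : Template A n) → Dec (∃ (Active t))
active? t = FinP.any? (λ i → nothing? (Vec.lookup t i))

lines : List A → (n : ℕ) → List (Template A n)
lines Λ n = List.filter active? (words (nothing ∷ List.map just Λ) n)

∈-lines⁺ : ∀ {Λ : List A} {t : Template A n} → IsLine Λ t → t ∈ lines Λ n
∈-lines⁺ {Λ = Λ} (t∈ , act) = ∈-filter⁺ active? (∈-words⁺ (VAll.map letter t∈)) act
  where
  letter : ∀ {x} → MAll.All (_∈ Λ) x → x ∈ nothing ∷ List.map just Λ
  letter MAll.nothing = here refl
  letter (MAll.just a∈) = there (∈-map⁺ just a∈)

∈-lines⁻ : ∀ {Λ : List A} {t : Template A n} → t ∈ lines Λ n → IsLine Λ t
∈-lines⁻ {n = n} {Λ = Λ} t∈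
  with w∈ , act ← ∈-filter⁻ active? {xs = words (nothing ∷ List.map just Λ) n} t∈ = VAll.map letter (∈-words⁻ w∈) , act
  where
  letter : ∀ {x} → x ∈ nothing ∷ List.map just Λ → MAll.All (_∈ Λ) x
  letter (here refl) = MAll.nothing
  letter (there x∈) with _ , a∈ , refl ← ∈-map⁻ just x∈ = MAll.just a∈

active-++-constant : (t : Template A m) (w : Vec A n) (i : Fin (m + n)) →
  Active (t Vec.++ constant w) i → ∃ λ j → i ≡ j Fin.↑ˡ n
active-++-constant [] (_ ∷ w) (suc i) act with () , _ ← active-++-constant [] w i act
active-++-constant (_ ∷ t) w zero act = zero , refl
active-++-constant (_ ∷ t) w (suc i) act with j , refl ← active-++-constant t w i act = suc j , refl

active-constant-++ : (w : Vec A m) (t : Template A n) (i : Fin (m + n)) →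
  Active (constant w Vec.++ t) i → ∃ λ j → i ≡ m Fin.↑ʳ j × Active t j
active-constant-++ [] t i act = i , refl , act
active-constant-++ (_ ∷ w) t (suc i) act with j , refl , act′ ← active-constant-++ w t i act = j , refl , act′

↑ˡ≢↑ʳ : (i : Fin m) (j : Fin n) → i Fin.↑ˡ n ≢ m Fin.↑ʳ j
↑ˡ≢↑ʳ (suc i) j eq = ↑ˡ≢↑ʳ i j (FinP.suc-injective eq)

-- Each ℓ in `ls` has active coordinates of its own, so an active coordinate of a tagged template
-- reveals the tag. The word s is chosen before ℓ and serves all ℓ simultaneously.
record Chunks (Λ : List A) (r N : ℕ) (ls : List (Template A N)) : Set where
  field
    dim : ℕ
    tagged : List (Template A N × Template A dim)
    tagged-line : ∀ {ℓ t} → (ℓ , t) ∈ tagged → ℓ ∈ ls × IsLine Λ t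
    active-determines : ∀ {ℓ t ℓ′ t′} → (ℓ , t) ∈ tagged → (ℓ′ , t′) ∈ tagged →
      ∀ i → Active t i → Active t′ i → ℓ ≡ ℓ′
    indifferent : (c : Vec A N → Vec A dim → Fin r) → Σ (Vec A dim) λ s → VAll.All (_∈ Λ) s ×
      (∀ {ℓ} → ℓ ∈ ls → Σ (Template A dim) λ t → (ℓ , t) ∈ tagged ×
        (∀ {u a} → VAll.All (_∈ Λ) u → a ∈ Λ → c u (fill t a) ≡ c u s))

-- One block of coordinates is prepended per ℓ. Lines tagged by ℓ₀ are active only inside the new
-- block, the others only outside it.
chunks : (q : A) (Λ′ : List A) (r N : ℕ) (ls : List (Template A N)) → Chunks (q ∷ Λ′) r N ls
chunks q Λ′ r N [] = record
  { dim = 0 ; tagged = [] ; tagged-line = λ () ; active-determines = λ ()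
  ; indifferent = λ c → [] , [] , λ () }
chunks {A} q Λ′ r N (ℓ₀ ∷ ls) = record
  { dim = l + M
  ; tagged = tagged′
  ; tagged-line = λ e → tagged-line′ (view e)
  ; active-determines = λ e e′ → determines (view e) (view e′)
  ; indifferent = indifferent′ }
  where
  Λ = q ∷ Λ′
  open Chunks (chunks q Λ′ r N ls) renaming (dim to M)
  -- M is already known, so one line of the new block can be monochromatic for all pairs of a word
  -- of length N and a word of length M.
  hj = HalesJewett-family (hales-jewett Λ) (List.cartesianProduct (words Λ N) (words Λ M)) r
  l = proj₁ hj
  new : Template A l × Vec A M → Template A N × Template A (l + M)
  new (t , w) = ℓ₀ , t Vec.++ constant w
  old : Vec A l × (Template A N × Template A M) → Template A N × Template A (l + M)
  old (w , ℓ , t) = ℓ , constant w Vec.++ t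
  news = List.cartesianProduct (lines Λ l) (words Λ M)
  olds = List.cartesianProduct (words Λ l) tagged
  tagged′ = List.map new news List.++ List.map old olds

  data View : Template A N → Template A (l + M) → Set where
    isNew : ∀ {t w} → IsLine Λ t → VAll.All (_∈ Λ) w → View ℓ₀ (t Vec.++ constant w)
    isOld : ∀ {ℓ w t} → VAll.All (_∈ Λ) w → (ℓ , t) ∈ tagged → View ℓ (constant w Vec.++ t)

  view : ∀ {ℓ t} → (ℓ , t) ∈ tagged′ → View ℓ t
  view e with ∈-++⁻ (List.map new news) e
  ... | inj₁ e₁ with _ , e₂ , refl ← ∈-map⁻ new e₁
      with t∈ , w∈ ← ∈-cartesianProduct⁻ (lines Λ l) (words Λ M) e₂ = isNew (∈-lines⁻ t∈) (∈-words⁻ w∈)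
  ... | inj₂ e₁ with _ , e₂ , refl ← ∈-map⁻ old e₁
      with w∈ , t∈ ← ∈-cartesianProduct⁻ (words Λ l) tagged e₂ = isOld (∈-words⁻ w∈) t∈

  tagged-line′ : ∀ {ℓ t} → View ℓ t → ℓ ∈ ℓ₀ ∷ ls × IsLine Λ t
  tagged-line′ (isNew t-line w∈) = here refl , ++-lineˡ t-line (constant-fixedIn w∈)
  tagged-line′ (isOld w∈ e) = there (proj₁ (tagged-line e)) , ++-lineʳ (constant-fixedIn w∈) (proj₂ (tagged-line e))

  determines : ∀ {ℓ t ℓ′ t′} → View ℓ t → View ℓ′ t′ → ∀ i → Active t i → Active t′ i → ℓ ≡ ℓ′
  determines (isNew _ _) (isNew _ _) i _ _ = refl
  determines (isNew {t} {w} _ _) (isOld {w = w′} {t = t′} _ _) i act act′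
    with j , refl ← active-++-constant t w i act | j′ , eq , _ ← active-constant-++ w′ t′ i act′ =
    contradiction eq (↑ˡ≢↑ʳ j j′)
  determines (isOld {w = w′} {t = t′} _ _) (isNew {t} {w} _ _) i act′ act
    with j , refl ← active-++-constant t w i act | j′ , eq , _ ← active-constant-++ w′ t′ i act′ =
    contradiction eq (↑ˡ≢↑ʳ j j′)
  determines (isOld {w = w} {t = t} _ e) (isOld {w = w′} {t = t′} _ e′) i act act′
    with j , refl , a₁ ← active-constant-++ w t i act | j′ , eq , a₂ ← active-constant-++ w′ t′ i act′
    with refl ← FinP.↑ʳ-injective l j j′ eq = active-determines e e′ j a₁ a₂

  indifferent′ : (c : Vec A N → Vec A (l + M) → Fin r) → Σ (Vec A (l + M)) λ s → VAll.All (_∈ Λ) s ×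
      (∀ {ℓ} → ℓ ∈ ℓ₀ ∷ ls → Σ (Template A (l + M)) λ t → (ℓ , t) ∈ tagged′ ×
        (∀ {u a} → VAll.All (_∈ Λ) u → a ∈ Λ → c u (fill t a) ≡ c u s))
  indifferent′ c
    with t , t-line , mono ← proj₂ hj (λ { (u , y) x → c u (x Vec.++ y) })
    with s , s∈ , rest ← indifferent (λ u y → c u (fill t q Vec.++ y)) =
    fill t q Vec.++ s , VAllP.++⁺ tq∈ s∈ , choose
    where
    tq∈ = fill-∈ (proj₁ t-line) (here refl)
    choose : ∀ {ℓ} → ℓ ∈ ℓ₀ ∷ ls → Σ (Template A (l + M)) λ t′ → (ℓ , t′) ∈ tagged′ ×
        (∀ {u a} → VAll.All (_∈ Λ) u → a ∈ Λ → c u (fill t′ a) ≡ c u (fill t q Vec.++ s))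
    choose (here refl) = t Vec.++ constant s ,
      ∈-++⁺ˡ (∈-map⁺ new (∈-cartesianProduct⁺ (∈-lines⁺ t-line) (∈-words⁺ s∈))) ,
      λ {u} {a} u∈ a∈ → trans
        (cong (c u) (trans (VecP.map-++ _ t (constant s)) (cong (fill t a Vec.++_) (fill-constant s a))))
        (mono (∈-cartesianProduct⁺ (∈-words⁺ u∈) (∈-words⁺ s∈)) a∈ (here refl))
    choose (there ℓ∈) with t′ , e , same ← rest ℓ∈ = constant (fill t q) Vec.++ t′ ,
      ∈-++⁺ʳ (List.map new news) (∈-map⁺ old (∈-cartesianProduct⁺ (∈-words⁺ tq∈) e)) ,
      λ {u} {a} u∈ a∈ → trans
        (cong (c u) (trans (VecP.map-++ _ (constant (fill t q)) t′) (cong (Vec._++ fill t′ a) (fill-constant (fill t q) a))))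
        (same u∈ a∈)

third : ∀ {k} → 3 ≤ k → (i j : Fin k) → ∃ λ h → h ≢ i × h ≢ j
third (s≤s (s≤s (s≤s _))) zero zero = suc zero , (λ ()) , (λ ())
third (s≤s (s≤s (s≤s _))) zero (suc zero) = suc (suc zero) , (λ ()) , (λ ())
third (s≤s (s≤s (s≤s _))) zero (suc (suc _)) = suc zero , (λ ()) , (λ ())
third (s≤s (s≤s (s≤s _))) (suc zero) zero = suc (suc zero) , (λ ()) , (λ ())
third (s≤s (s≤s (s≤s _))) (suc (suc _)) zero = suc zero , (λ ()) , (λ ())
third (s≤s (s≤s (s≤s _))) (suc _) (suc _) = zero , (λ ()) , (λ ())

-- This is the pattern that the active sets of k templates would show if a nondegenerate similar
-- copy in an amalgam had labels not forming an edge.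
AlmostCover : ∀ {k} → (Fin k → Template A n) → Set
AlmostCover t = ∀ i → (∀ j → ¬ Active (t j) i) ⊎
  (∃ λ j → ¬ Active (t j) i × (∀ j′ → j′ ≢ j → Active (t j′) i))

record SparseLines (Λ : List A) (r : ℕ) : Set where
  field
    dim : ℕ
    family : List (Template A dim)
    family-line : ∀ {t} → t ∈ family → IsLine Λ t
    no-almost-cover : ∀ {k} → 3 ≤ k → (t : Fin k → Template A dim) → (∀ j → t j ∈ family) → ¬ AlmostCover t
    ramsey : (c : Vec A dim → Fin r) → Σ (Template A dim) λ t → t ∈ family × MonoOn Λ t c

sparse-lines : (q : A) (Λ′ : List A) (r : ℕ) → SparseLines (q ∷ Λ′) r
sparse-lines {A} q Λ′ r = record
  { dim = N + M ; family = List.map glue tagged ; family-line = family-line′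
  ; no-almost-cover = no-cover ; ramsey = ramsey′ }
  where
  Λ = q ∷ Λ′
  hj = hales-jewett Λ r
  N = proj₁ hj
  open Chunks (chunks q Λ′ r N (lines Λ N)) renaming (dim to M)
  glue : Template A N × Template A M → Template A (N + M)
  glue (ℓ , t) = ℓ Vec.++ t

  family-line′ : ∀ {t} → t ∈ List.map glue tagged → IsLine Λ t
  family-line′ t∈ with _ , e , refl ← ∈-map⁻ glue t∈ =
    ++-lineʳ (proj₁ (∈-lines⁻ (proj₁ (tagged-line e)))) (proj₂ (tagged-line e))

  -- The second part of each template is active somewhere, and there all templates but one are
  -- active, hence share their tag. As k ≥ 3, these groups overlap and all tags are equal. At an
  -- active position of the common tag all k templates are active, which an almost-cover excludes.
  no-cover : ∀ {k} → 3 ≤ k → (t : Fin k → Template A (N + M)) → (∀ j → t j ∈ List.map glue tagged) → ¬ AlmostCover t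
  no-cover {k} 3≤k t t∈ cover = absurd (cover (i₀ Fin.↑ˡ M))
    where
    origin : ∀ j → ∃ λ e → e ∈ tagged × t j ≡ glue e
    origin j = ∈-map⁻ glue (t∈ j)
    ℓ : Fin k → Template A N
    ℓ j = proj₁ (proj₁ (origin j))
    s : Fin k → Template A M
    s j = proj₂ (proj₁ (origin j))
    e∈ : ∀ j → (ℓ j , s j) ∈ tagged
    e∈ j = proj₁ (proj₂ (origin j))
    lookupˡ : ∀ j i → Vec.lookup (t j) (i Fin.↑ˡ M) ≡ Vec.lookup (ℓ j) i
    lookupˡ j i = trans (cong (λ x → Vec.lookup x (i Fin.↑ˡ M)) (proj₂ (proj₂ (origin j)))) (VecP.lookup-++ˡ (ℓ j) (s j) i)
    lookupʳ : ∀ j i → Vec.lookup (t j) (N Fin.↑ʳ i) ≡ Vec.lookup (s j) i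
    lookupʳ j i = trans (cong (λ x → Vec.lookup x (N Fin.↑ʳ i)) (proj₂ (proj₂ (origin j)))) (VecP.lookup-++ʳ (ℓ j) (s j) i)
    agree : ∀ j → ∃ λ z → ∀ h → h ≢ z → ℓ j ≡ ℓ h
    agree j with i , act ← proj₂ (proj₂ (tagged-line (e∈ j))) with cover (N Fin.↑ʳ i)
    ... | inj₁ none = contradiction (trans (lookupʳ j i) act) (none j)
    ... | inj₂ (z , _ , others) = z , λ h h≢z →
      active-determines (e∈ j) (e∈ h) i act (trans (sym (lookupʳ h i)) (others h h≢z))
    all-equal : ∀ j h → ℓ j ≡ ℓ h
    all-equal j h with z , eq ← agree j with h FinP.≟ z
    ... | no h≢z = eq h h≢z
    ... | yes refl with z′ , eq′ ← agree h with x , x≢h , x≢z′ ← third 3≤k h z′ =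
      trans (eq x x≢h) (sym (eq′ x x≢z′))
    j₀ : Fin k
    j₀ = Fin.fromℕ< (ℕP.≤-trans (s≤s z≤n) 3≤k)
    i₀ : Fin N
    i₀ = proj₁ (proj₂ (∈-lines⁻ (proj₁ (tagged-line (e∈ j₀)))))
    active₀ : Active (ℓ j₀) i₀
    active₀ = proj₂ (proj₂ (∈-lines⁻ (proj₁ (tagged-line (e∈ j₀)))))
    active-all : ∀ j → Active (t j) (i₀ Fin.↑ˡ M)
    active-all j = trans (lookupˡ j i₀) (trans (cong (λ x → Vec.lookup x i₀) (all-equal j j₀)) active₀)
    absurd : ¬ ((∀ j → ¬ Active (t j) (i₀ Fin.↑ˡ M)) ⊎
      (∃ λ j → ¬ Active (t j) (i₀ Fin.↑ˡ M) × (∀ j′ → j′ ≢ j → Active (t j′) (i₀ Fin.↑ˡ M))))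
    absurd (inj₁ none) = none j₀ (active-all j₀)
    absurd (inj₂ (j , inactive , _)) = inactive (active-all j)

  -- The word s is fixed before ℓ is known. The line ℓ is monochromatic with s appended, and moving
  -- in the block of ℓ at the same time does not change the colour.
  ramsey′ : (c : Vec A (N + M) → Fin r) → Σ (Template A (N + M)) λ t → t ∈ List.map glue tagged × MonoOn Λ t c
  ramsey′ c
    with s , _ , choose ← indifferent (λ u x → c (u Vec.++ x))
    with ℓ , ℓ-line , mono ← proj₂ hj (λ u → c (u Vec.++ s))
    with t , e , same ← choose (∈-lines⁺ ℓ-line) =
    ℓ Vec.++ t , ∈-map⁺ glue e , λ {a} {b} a∈ b∈ → begin
      c (fill (ℓ Vec.++ t) a)       ≡⟨ cong c (VecP.map-++ _ ℓ t) ⟩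
      c (fill ℓ a Vec.++ fill t a)  ≡⟨ same (fill-∈ (proj₁ ℓ-line) a∈) a∈ ⟩
      c (fill ℓ a Vec.++ s)         ≡⟨ mono a∈ b∈ ⟩
      c (fill ℓ b Vec.++ s)         ≡⟨ same (fill-∈ (proj₁ ℓ-line) b∈) b∈ ⟨
      c (fill ℓ b Vec.++ fill t b)  ≡⟨ cong c (VecP.map-++ _ ℓ t) ⟨
      c (fill (ℓ Vec.++ t) b)       ∎
    where open ≡-Reasoning

abstract
  sparse-hales-jewett : (q : A) (Λ′ : List A) (r : ℕ) → SparseLines (q ∷ Λ′) r
  sparse-hales-jewett = sparse-lines

-- Distances and rapidly growing weights

0+0≡0 : ∀ {x y : ℤ} → + 0 ℤ.≤ x → + 0 ℤ.≤ y → x ℤ.+ y ≡ + 0 → x ≡ + 0 × y ≡ + 0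
0+0≡0 {+ zero} {+ zero} _ _ _ = refl , refl

square≥0 : (x : ℤ) → + 0 ℤ.≤ x ℤ.* x
square≥0 (+ zero) = ℤ.+≤+ z≤n
square≥0 (ℤ.+[1+ n ]) = ℤ.+≤+ z≤n
square≥0 (ℤ.-[1+ n ]) = ℤ.+≤+ z≤n

‖‖²≥0 : (x : Point d) → + 0 ℤ.≤ ‖ x ‖²
‖‖²≥0 [] = ℤ.+≤+ z≤n
‖‖²≥0 (x ∷ xs) = ℤP.+-mono-≤ (square≥0 x) (‖‖²≥0 xs)

dist² : Point d → Point d → ℤ
dist² x y = ‖ x ⊖ y ‖²

dist²≡0⇒≡ : (x y : Point d) → dist² x y ≡ + 0 → x ≡ y
dist²≡0⇒≡ [] [] _ = refl
dist²≡0⇒≡ (x ∷ xs) (y ∷ ys) eq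
  with p , q ← 0+0≡0 (square≥0 (x ℤ.- y)) (‖‖²≥0 (xs ⊖ ys)) eq =
  cong₂ _∷_ (ℤP.i-j≡0⇒i≡j x y (square≡0 p)) (dist²≡0⇒≡ xs ys q)
  where
  square≡0 : ∀ {z} → z ℤ.* z ≡ + 0 → z ≡ + 0
  square≡0 {z} e with ℤP.i*j≡0⇒i≡0∨j≡0 z e
  ... | inj₁ p = p
  ... | inj₂ p = p

dist²-self : (x : Point d) → dist² x x ≡ + 0
dist²-self [] = refl
dist²-self (x ∷ xs) = cong₂ (λ u v → u ℤ.* u ℤ.+ v) (ℤP.+-inverseʳ x) (dist²-self xs)

-- Twice the inner product of a ⊖ a′ and b ⊖ b′.
cross : (a a′ b b′ : Point d) → ℤ
cross [] [] [] [] = + 0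
cross (a ∷ as) (a′ ∷ as′) (b ∷ bs) (b′ ∷ bs′) =
  + 2 ℤ.* ((a ℤ.- a′) ℤ.* (b ℤ.- b′)) ℤ.+ cross as as′ bs bs′

dist²-expand : (l : ℤ) (a a′ b b′ : Point d) →
  dist² (a ⊕ (l ⊙ b)) (a′ ⊕ (l ⊙ b′)) ≡ dist² a a′ ℤ.+ l ℤ.* (cross a a′ b b′ ℤ.+ l ℤ.* dist² b b′)
dist²-expand l [] [] [] [] = zeros l
  where
  zeros : ∀ l → + 0 ≡ + 0 ℤ.+ l ℤ.* (+ 0 ℤ.+ l ℤ.* + 0)
  zeros = ℤSolver.solve-∀
dist²-expand l (a ∷ as) (a′ ∷ as′) (b ∷ bs) (b′ ∷ bs′) =
  trans (cong (ℤ._+_ (δ ℤ.* δ)) (dist²-expand l as as′ bs bs′))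
    (rearrange l a a′ b b′ (dist² as as′) (cross as as′ bs bs′) (dist² bs bs′))
  where
  δ = (a ℤ.+ l ℤ.* b) ℤ.- (a′ ℤ.+ l ℤ.* b′)
  rearrange : ∀ l a a′ b b′ x y z →
    ((a ℤ.+ l ℤ.* b) ℤ.- (a′ ℤ.+ l ℤ.* b′)) ℤ.* ((a ℤ.+ l ℤ.* b) ℤ.- (a′ ℤ.+ l ℤ.* b′)) ℤ.+
      (x ℤ.+ l ℤ.* (y ℤ.+ l ℤ.* z)) ≡
    ((a ℤ.- a′) ℤ.* (a ℤ.- a′) ℤ.+ x) ℤ.+
      l ℤ.* ((+ 2 ℤ.* ((a ℤ.- a′) ℤ.* (b ℤ.- b′)) ℤ.+ y) ℤ.+ l ℤ.* ((b ℤ.- b′) ℤ.* (b ℤ.- b′) ℤ.+ z))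
  rearrange = ℤSolver.solve-∀

-- The absolute value of x is a multiple of l and less than l.
small-multiple : ∀ {l} (x y : ℤ) → ∣ x ∣ < l → x ℤ.+ + l ℤ.* y ≡ + 0 → x ≡ + 0 × y ≡ + 0
small-multiple {l} x y x<l eq = x≡0 , y≡0
  where
  abs-eq : ∣ x ∣ ≡ l * ∣ y ∣
  abs-eq = trans (cong ∣_∣ (x≡-y x (+ l ℤ.* y) eq)) (trans (ℤP.∣-i∣≡∣i∣ (+ l ℤ.* y)) (ℤP.abs-* (+ l) y))
    where
    x≡-y : ∀ x y → x ℤ.+ y ≡ + 0 → x ≡ ℤ.- y
    x≡-y x y e = trans (lemma x y) (trans (cong (ℤ._- y) e) (ℤP.+-identityˡ (ℤ.- y)))
      where
      lemma : ∀ x y → x ≡ x ℤ.+ y ℤ.- y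
      lemma = ℤSolver.solve-∀
  zero-or : ∀ n → ∣ x ∣ ≡ l * n → n ≡ 0
  zero-or zero _ = refl
  zero-or (suc n) e = contradiction (subst (_< l) e x<l) (ℕP.≤⇒≯ (ℕP.m≤m*n l (suc n)))
  y≡0 = ℤP.∣i∣≡0⇒i≡0 (zero-or ∣ y ∣ abs-eq)
  x≡0 = ℤP.∣i∣≡0⇒i≡0 (trans abs-eq (trans (cong (l *_) (zero-or ∣ y ∣ abs-eq)) (ℕP.*-zeroʳ l)))

small-quadratic : ∀ {l} (x y z : ℤ) → ∣ x ∣ < l → ∣ y ∣ < l →
  x ℤ.+ + l ℤ.* (y ℤ.+ + l ℤ.* z) ≡ + 0 → x ≡ + 0 × z ≡ + 0
small-quadratic x y z x<l y<l eq with x≡0 , e ← small-multiple x _ x<l eq =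
  x≡0 , proj₂ (small-multiple y z y<l e)

upper-bound : (f : A → ℕ) (xs : List A) → Σ ℕ λ b → ∀ {x} → x ∈ xs → f x ≤ b
upper-bound f [] = 0 , λ ()
upper-bound f (x ∷ xs) with b , bound ← upper-bound f xs =
  f x ℕ.⊔ b , λ { (here refl) → ℕP.m≤m⊔n (f x) b ; (there x∈) → ℕP.≤-trans (bound x∈) (ℕP.m≤n⊔m (f x) b) }

module Similarity {d k : ℕ} (F : Fin k → Point d) where

  -- For injective F, either all points of φ coincide or φ is congruent to a dilate of F.
  Sim : (Fin k → Point d) → Set
  Sim φ = ∀ i j i′ j′ → dist² (φ i) (φ j) ℤ.* dist² (F i′) (F j′) ≡ dist² (φ i′) (φ j′) ℤ.* dist² (F i) (F j)

  Sim-cong : ∀ {φ χ} → (∀ i → φ i ≡ χ i) → Sim φ → Sim χ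
  Sim-cong eq sim i j i′ j′ = subst₂ (λ x y → x ℤ.* dist² (F i′) (F j′) ≡ y ℤ.* dist² (F i) (F j))
    (cong₂ dist² (eq i) (eq j)) (cong₂ dist² (eq i′) (eq j′)) (sim i j i′ j′)

  -- Such an l behaves like an indeterminate: relations between sums a + l b descend to the constant
  -- and the leading coefficients.
  Separates : List (Point d) → List (Point d) → ℕ → Set
  Separates A B l =
    (∀ φ χ → (∀ i → φ i ∈ A) → (∀ i → χ i ∈ B) → Sim (λ i → φ i ⊕ ((+ l) ⊙ χ i)) → Sim φ × Sim χ) ×
    (∀ {a a′ b b′} → a ∈ A → a′ ∈ A → b ∈ B → b′ ∈ B →
      a ⊕ ((+ l) ⊙ b) ≡ a′ ⊕ ((+ l) ⊙ b′) → a ≡ a′ × b ≡ b′)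

  private
    Quad = (Point d × Point d) × (Point d × Point d)
    Item = Quad × (Fin k × Fin k)

    sizeQ : Quad → ℕ
    sizeQ ((a , a′) , (b , b′)) = ∣ dist² a a′ ∣ + ∣ cross a a′ b b′ ∣

    sizeI : Item × Item → ℕ
    sizeI ((((a , a′) , (b , b′)) , (i , j)) , (((x , x′) , (y , y′)) , (i′ , j′))) =
      ∣ dist² a a′ ℤ.* dist² (F i′) (F j′) ℤ.- dist² x x′ ℤ.* dist² (F i) (F j) ∣ +
      ∣ cross a a′ b b′ ℤ.* dist² (F i′) (F j′) ℤ.- cross x x′ y y′ ℤ.* dist² (F i) (F j) ∣

    collect : ∀ l x y z x′ y′ z′ D D′ →
      (x ℤ.+ l ℤ.* (y ℤ.+ l ℤ.* z)) ℤ.* D′ ℤ.- (x′ ℤ.+ l ℤ.* (y′ ℤ.+ l ℤ.* z′)) ℤ.* D ≡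
      (x ℤ.* D′ ℤ.- x′ ℤ.* D) ℤ.+ l ℤ.* ((y ℤ.* D′ ℤ.- y′ ℤ.* D) ℤ.+ l ℤ.* (z ℤ.* D′ ℤ.- z′ ℤ.* D))
    collect = ℤSolver.solve-∀

  -- Each equation of `Sim` for the sums is quadratic in l. There are finitely many constant and
  -- linear coefficients; once l exceeds them, the constant and the quadratic coefficient must
  -- vanish, and these give the equations for φ and χ. Injectivity follows likewise from a vanishing
  -- squared distance.
  separating-scale : (A B : List (Point d)) (l₀ : ℕ) → Σ ℕ λ l → l₀ < l × Separates A B l
  separating-scale A B l₀ = l , s≤s (ℕP.m≤n+m l₀ (KI + KQ)) , sim , inj
    where
    quads = List.cartesianProduct (List.cartesianProduct A A) (List.cartesianProduct B B)
    items = List.cartesianProduct quads (List.cartesianProduct (List.allFin k) (List.allFin k))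
    boundI = upper-bound sizeI (List.cartesianProduct items items)
    boundQ = upper-bound sizeQ quads
    KI = proj₁ boundI
    KQ = proj₁ boundQ
    l = suc (KI + KQ + l₀)

    belowI : ∀ {n} → n ≤ KI → n < l
    belowI n≤ = s≤s (ℕP.≤-trans n≤ (ℕP.≤-trans (ℕP.m≤m+n KI KQ) (ℕP.m≤m+n (KI + KQ) l₀)))
    belowQ : ∀ {n} → n ≤ KQ → n < l
    belowQ n≤ = s≤s (ℕP.≤-trans n≤ (ℕP.≤-trans (ℕP.m≤n+m KQ KI) (ℕP.m≤m+n (KI + KQ) l₀)))

    quad∈ : ∀ {a a′ b b′} → a ∈ A → a′ ∈ A → b ∈ B → b′ ∈ B → ((a , a′) , (b , b′)) ∈ quads
    quad∈ a∈ a′∈ b∈ b′∈ = ∈-cartesianProduct⁺ (∈-cartesianProduct⁺ a∈ a′∈) (∈-cartesianProduct⁺ b∈ b′∈)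

    sim : ∀ φ χ → (∀ i → φ i ∈ A) → (∀ i → χ i ∈ B) → Sim (λ i → φ i ⊕ ((+ l) ⊙ χ i)) → Sim φ × Sim χ
    sim φ χ φ∈ χ∈ s = (λ i j i′ j′ → proj₁ (both i j i′ j′)) , (λ i j i′ j′ → proj₂ (both i j i′ j′))
      where
      item∈ : ∀ i j → (((φ i , φ j) , (χ i , χ j)) , (i , j)) ∈ items
      item∈ i j = ∈-cartesianProduct⁺ (quad∈ (φ∈ i) (φ∈ j) (χ∈ i) (χ∈ j))
        (∈-cartesianProduct⁺ (∈-allFin i) (∈-allFin j))
      both : ∀ i j i′ j′ →
        dist² (φ i) (φ j) ℤ.* dist² (F i′) (F j′) ≡ dist² (φ i′) (φ j′) ℤ.* dist² (F i) (F j) ×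
        dist² (χ i) (χ j) ℤ.* dist² (F i′) (F j′) ≡ dist² (χ i′) (χ j′) ℤ.* dist² (F i) (F j)
      both i j i′ j′ = ℤP.i-j≡0⇒i≡j _ _ (proj₁ zeros) , ℤP.i-j≡0⇒i≡j _ _ (proj₂ zeros)
        where
        D = dist² (F i) (F j)
        D′ = dist² (F i′) (F j′)
        bound : sizeI ((((φ i , φ j) , (χ i , χ j)) , (i , j)) , (((φ i′ , φ j′) , (χ i′ , χ j′)) , (i′ , j′))) ≤ KI
        bound = proj₂ boundI (∈-cartesianProduct⁺ (item∈ i j) (item∈ i′ j′))
        expanded = subst₂ (λ x y → x ℤ.* D′ ≡ y ℤ.* D)
          (dist²-expand (+ l) (φ i) (φ j) (χ i) (χ j)) (dist²-expand (+ l) (φ i′) (φ j′) (χ i′) (χ j′)) (s i j i′ j′)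
        x = dist² (φ i) (φ j) ℤ.* D′ ℤ.- dist² (φ i′) (φ j′) ℤ.* D
        y = cross (φ i) (φ j) (χ i) (χ j) ℤ.* D′ ℤ.- cross (φ i′) (φ j′) (χ i′) (χ j′) ℤ.* D
        z = dist² (χ i) (χ j) ℤ.* D′ ℤ.- dist² (χ i′) (χ j′) ℤ.* D
        zeros = small-quadratic x y z (belowI (ℕP.m+n≤o⇒m≤o ∣ x ∣ bound)) (belowI (ℕP.m+n≤o⇒n≤o ∣ x ∣ bound))
          (trans (sym (collect (+ l) (dist² (φ i) (φ j)) (cross (φ i) (φ j) (χ i) (χ j)) (dist² (χ i) (χ j))
            (dist² (φ i′) (φ j′)) (cross (φ i′) (φ j′) (χ i′) (χ j′)) (dist² (χ i′) (χ j′)) D D′))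
            (ℤP.i≡j⇒i-j≡0 expanded))

    inj : ∀ {a a′ b b′} → a ∈ A → a′ ∈ A → b ∈ B → b′ ∈ B →
      a ⊕ ((+ l) ⊙ b) ≡ a′ ⊕ ((+ l) ⊙ b′) → a ≡ a′ × b ≡ b′
    inj {a} {a′} {b} {b′} a∈ a′∈ b∈ b′∈ eq = dist²≡0⇒≡ a a′ (proj₁ zeros) , dist²≡0⇒≡ b b′ (proj₂ zeros)
      where
      bound : sizeQ ((a , a′) , (b , b′)) ≤ KQ
      bound = proj₂ boundQ (quad∈ a∈ a′∈ b∈ b′∈)
      zeros = small-quadratic (dist² a a′) (cross a a′ b b′) (dist² b b′)
        (belowQ (ℕP.m+n≤o⇒m≤o _ bound)) (belowQ (ℕP.m+n≤o⇒n≤o _ bound))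
        (trans (sym (dist²-expand (+ l) a a′ b b′))
          (trans (cong (dist² (a ⊕ ((+ l) ⊙ b))) (sym eq)) (dist²-self (a ⊕ ((+ l) ⊙ b)))))

  abstract
    separating : (A B : List (Point d)) (l₀ : ℕ) → Σ ℕ λ l → l₀ < l × Separates A B l
    separating = separating-scale

-- Pictures and the partite construction

origin ones : Point d
origin = Vec.replicate _ (+ 0)
ones = Vec.replicate _ (+ 1)

⊕⊙-origin : (l : ℤ) (x : Point d) → x ⊕ (l ⊙ origin) ≡ x
⊕⊙-origin l [] = refl
⊕⊙-origin l (x ∷ xs) = cong₂ _∷_ (lemma l x) (⊕⊙-origin l xs)
  where
  lemma : ∀ l x → x ℤ.+ l ℤ.* + 0 ≡ x
  lemma = ℤSolver.solve-∀

⊕⊙-comm : (l : ℤ) (x y : Point d) → x ⊕ (l ⊙ y) ≡ (l ⊙ y) ⊕ ((+ 1) ⊙ x)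
⊕⊙-comm l [] [] = refl
⊕⊙-comm l (x ∷ xs) (y ∷ ys) = cong₂ _∷_ (lemma l x y) (⊕⊙-comm l xs ys)
  where
  lemma : ∀ l x y → x ℤ.+ l ℤ.* y ≡ l ℤ.* y ℤ.+ + 1 ℤ.* x
  lemma = ℤSolver.solve-∀

⊕⊙-absorb : (l w : ℤ) (x y : Point d) → x ⊕ (l ⊙ (y ⊕ (w ⊙ x))) ≡ (l ⊙ y) ⊕ ((+ 1 ℤ.+ l ℤ.* w) ⊙ x)
⊕⊙-absorb l w [] [] = refl
⊕⊙-absorb l w (x ∷ xs) (y ∷ ys) = cong₂ _∷_ (lemma l w x y) (⊕⊙-absorb l w xs ys)
  where
  lemma : ∀ l w x y → x ℤ.+ l ℤ.* (y ℤ.+ w ℤ.* x) ≡ l ℤ.* y ℤ.+ (+ 1 ℤ.+ l ℤ.* w) ℤ.* x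
  lemma = ℤSolver.solve-∀

⊕⊙-compose : (l w : ℤ) (x y z : Point d) → x ⊕ (l ⊙ (y ⊕ (w ⊙ z))) ≡ (x ⊕ (l ⊙ y)) ⊕ ((l ℤ.* w) ⊙ z)
⊕⊙-compose l w [] [] [] = refl
⊕⊙-compose l w (x ∷ xs) (y ∷ ys) (z ∷ zs) = cong₂ _∷_ (lemma l w x y z) (⊕⊙-compose l w xs ys zs)
  where
  lemma : ∀ l w x y z → x ℤ.+ l ℤ.* (y ℤ.+ w ℤ.* z) ≡ (x ℤ.+ l ℤ.* y) ℤ.+ (l ℤ.* w) ℤ.* z
  lemma = ℤSolver.solve-∀

-- Homotheties, and words of points as weighted sums.

record Homothety (d : ℕ) : Set where
  constructor homothety
  field
    shift : Point d
    ratio : ℕ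
    ratio≥1 : 1 ≤ ratio

open Homothety

apply : Homothety d → Point d → Point d
apply h x = shift h ⊕ ((+ ratio h) ⊙ x)

identity : Homothety d
identity = homothety origin 1 (s≤s z≤n)

apply-identity : (x : Point d) → apply identity x ≡ x
apply-identity [] = refl
apply-identity (x ∷ xs) = cong₂ _∷_ (lemma x) (apply-identity xs)
  where
  lemma : ∀ x → + 0 ℤ.+ + 1 ℤ.* x ≡ x
  lemma = ℤSolver.solve-∀

_∘ₕ_ : Homothety d → Homothety d → Homothety d
g ∘ₕ h = homothety (apply g (shift h)) (ratio g * ratio h) (ℕP.*-mono-≤ (ratio≥1 g) (ratio≥1 h))

apply-∘ₕ : (g h : Homothety d) (x : Point d) → apply (g ∘ₕ h) x ≡ apply g (apply h x)
apply-∘ₕ g h x = sym (trans (⊕⊙-compose (+ ratio g) (+ ratio h) (shift g) (shift h) x)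
  (cong (λ w → (shift g ⊕ ((+ ratio g) ⊙ shift h)) ⊕ (w ⊙ x)) (sym (ℤP.pos-* (ratio g) (ratio h)))))

horner : Vec ℕ n → Vec (Point d) n → Point d
horner [] [] = origin
horner (l ∷ ls) (x ∷ xs) = x ⊕ ((+ l) ⊙ horner ls xs)

positions : ∀ {V : Set} → Template (Point d × V) n → Point d × V → Vec (Point d) n
positions t p = Vec.map proj₁ (fill t p)

-- Along a combinatorial line the weighted sum is a homothety of the varying point. Its ratio w adds
-- up the weights of the active positions and is therefore positive.
affine : ∀ {V : Set} (ls : Vec ℕ n) → VAll.All (1 ≤_) ls → (t : Template (Point d × V) n) →
  Σ (Point d) λ o → Σ ℕ λ w → (∃ (Active t) → 1 ≤ w) ×
    (∀ p → horner ls (positions t p) ≡ o ⊕ ((+ w) ⊙ proj₁ p))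
affine [] [] [] = origin , 0 , (λ ()) , λ p → zeros (proj₁ p)
  where
  zeros : (x : Point d) → origin ≡ origin ⊕ ((+ 0) ⊙ x)
  zeros [] = refl
  zeros (x ∷ xs) = cong (+ 0 ∷_) (zeros xs)
affine (l ∷ ls) (1≤l ∷ 1≤ls) (nothing ∷ t) with o , w , _ , eq ← affine ls 1≤ls t =
  (+ l) ⊙ o , 1 + l * w , (λ _ → s≤s z≤n) , λ p → trans
    (cong (λ y → proj₁ p ⊕ ((+ l) ⊙ y)) (eq p))
    (trans (⊕⊙-absorb (+ l) (+ w) (proj₁ p) o)
      (cong (λ z → ((+ l) ⊙ o) ⊕ ((+ 1 ℤ.+ z) ⊙ proj₁ p)) (sym (ℤP.pos-* l w))))
affine (l ∷ ls) (1≤l ∷ 1≤ls) (just (x , _) ∷ t) with o , w , 1≤w , eq ← affine ls 1≤ls t =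
  x ⊕ ((+ l) ⊙ o) , l * w ,
  (λ { (suc i , act) → ℕP.*-mono-≤ 1≤l (1≤w (i , act)) }) , λ p → trans
    (cong (λ y → x ⊕ ((+ l) ⊙ y)) (eq p))
    (trans (⊕⊙-compose (+ l) (+ w) x o (proj₁ p))
      (cong (λ z → (x ⊕ ((+ l) ⊙ o)) ⊕ (z ⊙ proj₁ p)) (sym (ℤP.pos-* l w))))

magnitude : Point d → ℕ
magnitude [] = 0
magnitude (x ∷ xs) = ∣ x ∣ + magnitude xs

translate-nonneg : (l : ℕ) (x : Point d) → magnitude x ≤ l → VAll.All (+ 0 ℤ.≤_) (x ⊕ ((+ l) ⊙ ones))
translate-nonneg l [] _ = []
translate-nonneg l (x ∷ xs) x≤ = head x (ℕP.m+n≤o⇒m≤o ∣ x ∣ x≤) ∷ translate-nonneg l xs (ℕP.m+n≤o⇒n≤o ∣ x ∣ x≤)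
  where
  head : ∀ x → ∣ x ∣ ≤ l → + 0 ℤ.≤ x ℤ.+ + l ℤ.* + 1
  head x x≤l rewrite ℤP.*-identityʳ (+ l) = go x x≤l
    where
    go : ∀ x → ∣ x ∣ ≤ l → + 0 ℤ.≤ x ℤ.+ + l
    go (+ _) _ = ℤ.+≤+ z≤n
    go (ℤ.-[1+ n ]) n<l rewrite ℤP.⊖-≥ n<l = ℤ.+≤+ z≤n

Fin-⊎ : ∀ {n} {P Q : Fin n → Set} → (∀ i → P i ⊎ Q i) → ∃ P ⊎ (∀ i → Q i)
Fin-⊎ {zero} f = inj₂ λ ()
Fin-⊎ {suc n} f with f zero | Fin-⊎ (λ i → f (suc i))
... | inj₁ p | _ = inj₁ (zero , p)
... | inj₂ _ | inj₁ (i , p) = inj₁ (suc i , p)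
... | inj₂ q | inj₂ qs = inj₂ λ { zero → q ; (suc i) → qs i }

letter : ∀ {Λ : List A} {t : Template A n} → FixedIn Λ t → ∀ a i →
  (Active t i × Vec.lookup (fill t a) i ≡ a) ⊎ (¬ Active t i × Vec.lookup (fill t a) i ∈ Λ)
letter (MAll.nothing ∷ _) a zero = inj₁ (refl , refl)
letter (MAll.just b∈ ∷ _) a zero = inj₂ ((λ ()) , b∈)
letter (_ ∷ t∈) a (suc i) = letter t∈ a i

module Pictures {d k : ℕ} (F : Fin k → Point d) (F-inj : ∀ {i j} → F i ≡ F j → i ≡ j) (3≤k : 3 ≤ k)
  (V : Set) (_≟_ : (v w : V) → Dec (v ≡ w))
  (Edge : (Fin k → V) → Set)
  (Edge-cong : ∀ {f g} → (∀ i → f i ≡ g i) → Edge f → Edge g)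
  (Edge-distinct : ∀ {f} → Edge f → ∀ {i j} → i ≢ j → f i ≢ f j) where

  open Similarity F

  i₀ i₁ : Fin k
  i₀ = Fin.fromℕ< (ℕP.≤-trans (s≤s z≤n) 3≤k)
  i₁ = proj₁ (third 3≤k i₀ i₀)

  i₁≢i₀ : i₁ ≢ i₀
  i₁≢i₀ = proj₁ (proj₂ (third 3≤k i₀ i₀))

  F-dist≢0 : ∀ {i j} → i ≢ j → dist² (F i) (F j) ≢ + 0
  F-dist≢0 {i} {j} i≢j eq = i≢j (F-inj (dist²≡0⇒≡ (F i) (F j) eq))

  -- Distinct points of F have nonzero distance, so by proportionality one vanishing distance
  -- between different indices forces all of them to vanish.
  Sim-dichotomy : ∀ {φ} → Sim φ → (∀ i j → φ i ≡ φ j) ⊎ (∀ {i j} → i ≢ j → φ i ≢ φ j)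
  Sim-dichotomy {φ} sim with dist² (φ i₁) (φ i₀) ℤP.≟ + 0
  ... | yes S₀≡0 = inj₁ λ i j → dist²≡0⇒≡ (φ i) (φ j) (zero-factor (trans (sim i j i₁ i₀)
          (trans (cong (ℤ._* dist² (F i) (F j)) S₀≡0) (ℤP.*-zeroˡ (dist² (F i) (F j))))))
    where
    zero-factor : ∀ {x} → x ℤ.* dist² (F i₁) (F i₀) ≡ + 0 → x ≡ + 0
    zero-factor {x} e with ℤP.i*j≡0⇒i≡0∨j≡0 x e
    ... | inj₁ p = p
    ... | inj₂ p = contradiction p (F-dist≢0 i₁≢i₀)
  ... | no S₀≢0 = inj₂ λ {i} {j} i≢j φi≡φj → absurd i≢j (trans (sym (sim i j i₁ i₀))
          (trans (cong (ℤ._* dist² (F i₁) (F i₀)) (trans (cong (dist² (φ i)) (sym φi≡φj)) (dist²-self (φ i))))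
            (ℤP.*-zeroˡ (dist² (F i₁) (F i₀)))))
    where
    absurd : ∀ {i j} → i ≢ j → dist² (φ i₁) (φ i₀) ℤ.* dist² (F i) (F j) ≢ + 0
    absurd i≢j e with ℤP.i*j≡0⇒i≡0∨j≡0 (dist² (φ i₁) (φ i₀)) e
    ... | inj₁ p = S₀≢0 p
    ... | inj₂ p = F-dist≢0 i≢j p

  -- Among three indices two share a value, so the copy is not injective and must be constant.
  two-valued-Sim : ∀ {χ x y} → Sim χ → (∀ i → χ i ≡ x ⊎ χ i ≡ y) → ∀ i j → χ i ≡ χ j
  two-valued-Sim {χ} sim values with Sim-dichotomy sim
  ... | inj₁ eq = eq
  ... | inj₂ distinct with i₂ , i₂≢i₀ , i₂≢i₁ ← third 3≤k i₀ i₁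
      with values i₀ | values i₁ | values i₂
  ... | inj₁ p | inj₁ q | _ = contradiction (trans q (sym p)) (distinct i₁≢i₀)
  ... | inj₂ p | inj₂ q | _ = contradiction (trans q (sym p)) (distinct i₁≢i₀)
  ... | inj₁ p | inj₂ q | inj₁ s = contradiction (trans s (sym p)) (distinct i₂≢i₀)
  ... | inj₁ p | inj₂ q | inj₂ s = contradiction (trans s (sym q)) (distinct i₂≢i₁)
  ... | inj₂ p | inj₁ q | inj₂ s = contradiction (trans s (sym p)) (distinct i₂≢i₀)
  ... | inj₂ p | inj₁ q | inj₁ s = contradiction (trans s (sym q)) (distinct i₂≢i₁)

  ones≢origin : ones {d} ≢ origin
  ones≢origin eq = i₁≢i₀ (F-inj (trivial d eq (F i₁) (F i₀)))
    where
    trivial : ∀ d → ones {d} ≡ origin → (x y : Point d) → x ≡ y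
    trivial zero _ [] [] = refl

  Picture : Set
  Picture = List (Point d × V)

  -- The invariant of the whole construction: by `copies-project`, points whose labels contain no
  -- edge contain no similar copy of F other than a repeated single point.
  record Faithful (P : Picture) : Set where
    field
      label-unique : ∀ {p p′} → p ∈ P → p′ ∈ P → proj₁ p ≡ proj₁ p′ → proj₂ p ≡ proj₂ p′
      copies-project : (φ : Fin k → Point d × V) → (∀ i → φ i ∈ P) → Sim (proj₁ ∘ φ) →
        (∀ i j → proj₁ (φ i) ≡ proj₁ (φ j)) ⊎ Edge (proj₂ ∘ φ)

  open Faithful

  move : Homothety d → Point d × V → Point d × V
  move h (x , v) = apply h x , v

  Embeds : Homothety d → Picture → Picture → Set
  Embeds h P Q = ∀ {p} → p ∈ P → move h p ∈ Q

  -- P stays in place, so that repeated unions are nested; only Q is moved, to points with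
  -- nonnegative coordinates.
  record Union (P Q : Picture) : Set where
    field
      union : Picture
      faithful : Faithful union
      left : ∀ {p} → p ∈ P → p ∈ union
      embed : Homothety d
      right : Embeds embed Q union
      origin-of : ∀ {p} → p ∈ union → (p ∈ P) ⊎ (VAll.All (+ 0 ℤ.≤_) (proj₁ p) × ∃ λ q → q ∈ Q × proj₂ p ≡ proj₂ q)

  -- Points of P are written x + l · origin, points of the translate of Q as x + l · ones. The
  -- multipliers of a similar copy form a similar copy with at most two values, hence are constant,
  -- and the copy lies on one side.
  separated-union : ∀ P Q → Faithful P → Faithful Q → Union P Q
  separated-union P Q fP fQ = record
    { union = R
    ; faithful = record { label-unique = λ p∈ p′∈ → unique (view p∈) (view p′∈) ; copies-project = project }
    ; left = ∈-++⁺ˡ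
    ; embed = homothety ((+ l) ⊙ ones) 1 (s≤s z≤n)
    ; right = λ {p} p∈ → ∈-++⁺ʳ P (subst (_∈ List.map translate Q) (cong (_, proj₂ p) (⊕⊙-comm (+ l) (proj₁ p) ones)) (∈-map⁺ translate p∈))
    ; origin-of = λ p∈ → origin′ (∈-++⁻ P p∈)
    }
    where
    points = List.map proj₁ P List.++ List.map proj₁ Q
    bound = upper-bound (magnitude ∘ proj₁) Q
    -- The lower bound on l keeps all coordinates of the translate nonnegative.
    chosen = separating points (origin ∷ ones ∷ []) (proj₁ bound)
    l = proj₁ chosen
    l₀<l = proj₁ (proj₂ chosen)
    separates : Separates points (origin ∷ ones ∷ []) l
    separates = proj₂ (proj₂ chosen)
    translate : Point d × V → Point d × V
    translate (x , v) = x ⊕ ((+ l) ⊙ ones) , v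
    R = P List.++ List.map translate Q

    origin′ : ∀ {p} → p ∈ P ⊎ p ∈ List.map translate Q →
      (p ∈ P) ⊎ (VAll.All (+ 0 ℤ.≤_) (proj₁ p) × ∃ λ q → q ∈ Q × proj₂ p ≡ proj₂ q)
    origin′ (inj₁ p∈) = inj₁ p∈
    origin′ (inj₂ p∈) with q , q∈ , refl ← ∈-map⁻ translate p∈ =
      inj₂ (translate-nonneg l (proj₁ q) (ℕP.≤-trans (proj₂ bound q∈) (ℕP.<⇒≤ l₀<l)) , q , q∈ , refl)

    data Side : Point d → Point d × V → Set where
      inP : ∀ {q} → q ∈ P → Side origin q
      inQ : ∀ {q} → q ∈ Q → Side ones q

    View : Point d × V → Set
    View p = Σ (Point d) λ b → Σ (Point d × V) λ q → Side b q × p ≡ (proj₁ q ⊕ ((+ l) ⊙ b) , proj₂ q)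

    view : ∀ {p} → p ∈ R → View p
    view p∈ with ∈-++⁻ P p∈
    ... | inj₁ p∈P = origin , _ , inP p∈P , cong (_, _) (sym (⊕⊙-origin (+ l) _))
    ... | inj₂ p∈Q with q , q∈ , refl ← ∈-map⁻ translate p∈Q = ones , q , inQ q∈ , refl

    side-point : ∀ {b q} → Side b q → proj₁ q ∈ points
    side-point (inP q∈) = ∈-++⁺ˡ (∈-map⁺ proj₁ q∈)
    side-point (inQ q∈) = ∈-++⁺ʳ (List.map proj₁ P) (∈-map⁺ proj₁ q∈)
    side-value : ∀ {b q} → Side b q → b ∈ origin ∷ ones ∷ []
    side-value (inP _) = here refl
    side-value (inQ _) = there (here refl)
    side-P : ∀ {b q} → Side b q → b ≡ origin → q ∈ P
    side-P (inP q∈) _ = q∈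
    side-P (inQ _) eq = contradiction eq ones≢origin
    side-Q : ∀ {b q} → Side b q → b ≡ ones → q ∈ Q
    side-Q (inP _) eq = contradiction (sym eq) ones≢origin
    side-Q (inQ q∈) _ = q∈

    unique : ∀ {p p′} → View p → View p′ → proj₁ p ≡ proj₁ p′ → proj₂ p ≡ proj₂ p′
    unique (b , q , s , refl) (b′ , q′ , s′ , refl) eq
      with x≡ , b≡ ← proj₂ separates (side-point s) (side-point s′) (side-value s) (side-value s′) eq
      with s
    ... | inP q∈ = label-unique fP q∈ (side-P s′ (sym b≡)) x≡
    ... | inQ q∈ = label-unique fQ q∈ (side-Q s′ (sym b≡)) x≡

    project : (φ : Fin k → Point d × V) → (∀ i → φ i ∈ R) → Sim (proj₁ ∘ φ) →
      (∀ i j → proj₁ (φ i) ≡ proj₁ (φ j)) ⊎ Edge (proj₂ ∘ φ)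
    project φ φ∈ sim = conclude (side i₀) refl
      where
      views : ∀ i → View (φ i)
      views i = view (φ∈ i)
      b : Fin k → Point d
      b i = proj₁ (views i)
      q : Fin k → Point d × V
      q i = proj₁ (proj₂ (views i))
      side : ∀ i → Side (b i) (q i)
      side i = proj₁ (proj₂ (proj₂ (views i)))
      φ≡ : ∀ i → φ i ≡ (proj₁ (q i) ⊕ ((+ l) ⊙ b i) , proj₂ (q i))
      φ≡ i = proj₂ (proj₂ (proj₂ (views i)))
      sims : Sim (proj₁ ∘ q) × Sim b
      sims = proj₁ separates (proj₁ ∘ q) b (side-point ∘ side) (side-value ∘ side) (Sim-cong (cong proj₁ ∘ φ≡) sim)
      values : ∀ i → b i ≡ origin ⊎ b i ≡ ones
      values i with side-value (side i)
      ... | here eq = inj₁ eq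
      ... | there (here eq) = inj₂ eq
      b-constant : ∀ i j → b i ≡ b j
      b-constant = two-valued-Sim (proj₂ sims) values
      transfer : (∀ i j → proj₁ (q i) ≡ proj₁ (q j)) ⊎ Edge (proj₂ ∘ q) →
        (∀ i j → proj₁ (φ i) ≡ proj₁ (φ j)) ⊎ Edge (proj₂ ∘ φ)
      transfer (inj₁ same) = inj₁ λ i j → trans (cong proj₁ (φ≡ i))
        (trans (cong₂ (λ x y → x ⊕ ((+ l) ⊙ y)) (same i j) (b-constant i j)) (sym (cong proj₁ (φ≡ j))))
      transfer (inj₂ edge) = inj₂ (Edge-cong (sym ∘ cong proj₂ ∘ φ≡) edge)
      conclude : ∀ {b₀ q₀} → Side b₀ q₀ → b i₀ ≡ b₀ → (∀ i j → proj₁ (φ i) ≡ proj₁ (φ j)) ⊎ Edge (proj₂ ∘ φ)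
      conclude (inP _) eq = transfer (copies-project fP q (λ i → side-P (side i) (trans (b-constant i i₀) eq)) (proj₁ sims))
      conclude (inQ _) eq = transfer (copies-project fQ q (λ i → side-Q (side i) (trans (b-constant i i₀) eq)) (proj₁ sims))

  abstract
    disjoint-union : ∀ P Q → Faithful P → Faithful Q → Union P Q
    disjoint-union = separated-union

  -- Each new weight separates the letters from the finitely many sums over the remaining positions,
  -- so similarity and equality descend to every position by induction.
  block-weights : (A : List (Point d)) (n : ℕ) → Σ (Vec ℕ n) λ ls → VAll.All (1 ≤_) ls ×
    ((φ : Fin k → Vec (Point d) n) → (∀ i → VAll.All (_∈ A) (φ i)) → Sim (horner ls ∘ φ) →
      ∀ m → Sim (λ i → Vec.lookup (φ i) m)) ×
    (∀ {w w′} → VAll.All (_∈ A) w → VAll.All (_∈ A) w′ → horner ls w ≡ horner ls w′ → w ≡ w′)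
  block-weights A zero = [] , [] , (λ _ _ _ ()) , λ { {[]} {[]} _ _ _ → refl }
  block-weights A (suc n)
    with ls , 1≤ls , sims , inj ← block-weights A n
    with l , 0<l , sep , sep-inj ← separating A (List.map (horner ls) (words A n)) 0 =
    l ∷ ls , 0<l ∷ 1≤ls , sims′ , inj′
    where
    tail∈ : ∀ {x} {w : Vec (Point d) n} → VAll.All (_∈ A) (x ∷ w) → horner ls w ∈ List.map (horner ls) (words A n)
    tail∈ (_ ∷ w∈) = ∈-map⁺ (horner ls) (∈-words⁺ w∈)
    sims′ : (φ : Fin k → Vec (Point d) (suc n)) → (∀ i → VAll.All (_∈ A) (φ i)) → Sim (horner (l ∷ ls) ∘ φ) →
      ∀ m → Sim (λ i → Vec.lookup (φ i) m)
    sims′ φ φ∈ sim = both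
      where
      η : ∀ i → φ i ≡ Vec.head (φ i) ∷ Vec.tail (φ i)
      η i with _ ∷ _ ← φ i = refl
      φ∈′ : ∀ i → VAll.All (_∈ A) (Vec.head (φ i) ∷ Vec.tail (φ i))
      φ∈′ i = subst (VAll.All (_∈ A)) (η i) (φ∈ i)
      split = sep (Vec.head ∘ φ) (horner ls ∘ Vec.tail ∘ φ) (λ i → VAll.head (φ∈′ i)) (λ i → tail∈ (φ∈′ i))
        (Sim-cong (λ i → cong (horner (l ∷ ls)) (η i)) sim)
      both : ∀ m → Sim (λ i → Vec.lookup (φ i) m)
      both zero = Sim-cong (λ i → sym (cong (λ w → Vec.lookup w zero) (η i))) (proj₁ split)
      both (suc m) = Sim-cong (λ i → sym (cong (λ w → Vec.lookup w (suc m)) (η i)))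
        (sims (Vec.tail ∘ φ) (λ i → VAll.tail (φ∈′ i)) (proj₂ split) m)
    inj′ : ∀ {w w′} → VAll.All (_∈ A) w → VAll.All (_∈ A) w′ → horner (l ∷ ls) w ≡ horner (l ∷ ls) w′ → w ≡ w′
    inj′ {_ ∷ _} {_ ∷ _} w∈ w′∈ eq
      with x≡ , e ← sep-inj (VAll.head w∈) (VAll.head w′∈) (tail∈ w∈) (tail∈ w′∈) eq =
      cong₂ _∷_ x≡ (inj (VAll.tail w∈) (VAll.tail w′∈) e)

  abstract
    weights : (A : List (Point d)) (n : ℕ) → Σ (Vec ℕ n) λ ls → VAll.All (1 ≤_) ls ×
      ((φ : Fin k → Vec (Point d) n) → (∀ i → VAll.All (_∈ A) (φ i)) → Sim (horner ls ∘ φ) →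
        ∀ m → Sim (λ i → Vec.lookup (φ i) m)) ×
      (∀ {w w′} → VAll.All (_∈ A) w → VAll.All (_∈ A) w′ → horner ls w ≡ horner ls w′ → w ≡ w′)
    weights = block-weights

  -- Amalgamation of copies of a picture over one label.

  record Amalgam (P : Picture) (v : V) (r : ℕ) : Set where
    field
      amalgam : Picture
      faithful : Faithful amalgam
      labels : ∀ {p} → p ∈ amalgam → ∃ λ q → q ∈ P × proj₂ p ≡ proj₂ q
      monochromatic : (c : Point d × V → Fin (suc r)) → Σ (Homothety d) λ h → Embeds h P amalgam ×
        Σ (Fin (suc r)) λ κ → ∀ {p} → p ∈ P → proj₂ p ≡ v → c (move h p) ≡ κ

  -- Every template t of the sparse family carries a copy of P: p goes to the word t with p at the
  -- active positions. Points labelled v become words over Λ, and only these may be shared by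
  -- different copies. A template monochromatic on Λ gives the desired embedding.
  amalgamate-over : ∀ {P} → Faithful P → (v : V) (r : ℕ) (Λ : List (Point d × V)) →
    (∀ {p} → p ∈ Λ → p ∈ P × proj₂ p ≡ v) → (∀ {p} → p ∈ P → proj₂ p ≡ v → p ∈ Λ) → Amalgam P v r
  amalgamate-over {P} fP v r [] _ complete = record
    { amalgam = P ; faithful = fP ; labels = λ p∈ → _ , p∈ , refl
    -- No point has label v, so P itself works with an arbitrary colour.
    ; monochromatic = λ c → identity ,
        (λ {p} p∈ → subst (_∈ P) (cong (_, proj₂ p) (sym (apply-identity (proj₁ p)))) p∈) ,
        zero , λ p∈ eq → contradiction (complete p∈ eq) λ () }
  amalgamate-over {P} fP v r Λ@(q₀ ∷ Λ′) sound complete = record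
    { amalgam = Q
    ; faithful = record
        { label-unique = λ p∈ p′∈ → unique (view p∈) (view p′∈)
        ; copies-project = λ φ φ∈ → project φ (λ i → view (φ∈ i)) }
    ; labels = λ p∈ → labels′ (view p∈)
    ; monochromatic = monochromatic′ }
    where
    open SparseLines (sparse-hales-jewett q₀ Λ′ (suc r))
    points = List.map proj₁ P
    chosen = weights points dim
    ls = proj₁ chosen
    1≤ls = proj₁ (proj₂ chosen)
    sims = proj₁ (proj₂ (proj₂ chosen))
    horner-inj = proj₂ (proj₂ (proj₂ chosen))
    place : Template (Point d × V) dim → Point d × V → Point d × V
    place t p = horner ls (positions t p) , proj₂ p
    Q = List.cartesianProductWith place family P

    View : Point d × V → Set
    View x = ∃ λ t → ∃ λ p → t ∈ family × p ∈ P × x ≡ place t p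
    view : ∀ {x} → x ∈ Q → View x
    view x∈ = ∈-cartesianProductWith⁻ place family P x∈

    labels′ : ∀ {x} → View x → ∃ λ q → q ∈ P × proj₂ x ≡ proj₂ q
    labels′ (_ , p , _ , p∈ , refl) = p , p∈ , refl

    block : Template (Point d × V) dim → Point d × V → Fin dim → Point d × V
    block t p m = Vec.lookup (fill t p) m
    block-∈ : ∀ {t p} → t ∈ family → p ∈ P → ∀ m → block t p m ∈ P
    block-∈ {p = p} t∈ p∈ m with letter (proj₁ (family-line t∈)) p m
    ... | inj₁ (_ , eq) = subst (_∈ P) (sym eq) p∈
    ... | inj₂ (_ , e) = proj₁ (sound e)
    positions-∈ : ∀ {t p} → t ∈ family → p ∈ P → VAll.All (_∈ points) (positions t p)
    positions-∈ t∈ p∈ = VAllP.map⁺ (VAllP.lookup⁻ (λ m → ∈-map⁺ proj₁ (block-∈ t∈ p∈ m)))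
    position-block : ∀ t p m → Vec.lookup (positions t p) m ≡ proj₁ (block t p m)
    position-block t p m = VecP.lookup-map m proj₁ (fill t p)
    block-label : ∀ {t p m} → t ∈ family → ¬ Active t m → proj₂ (block t p m) ≡ v
    block-label {p = p} {m} t∈ inactive with letter (proj₁ (family-line t∈)) p m
    ... | inj₁ (act , _) = contradiction act inactive
    ... | inj₂ (_ , e) = proj₂ (sound e)
    block-active : ∀ {t p m} → t ∈ family → Active t m → block t p m ≡ p
    block-active {p = p} {m} t∈ act with letter (proj₁ (family-line t∈)) p m
    ... | inj₁ (_ , eq) = eq
    ... | inj₂ (inactive , _) = contradiction act inactive
    block-off : ∀ {t p m} → t ∈ family → proj₂ (block t p m) ≢ v → Active t m × block t p m ≡ p
    block-off {p = p} {m} t∈ ≢v with letter (proj₁ (family-line t∈)) p m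
    ... | inj₁ res = res
    ... | inj₂ (_ , e) = contradiction (proj₂ (sound e)) ≢v

    -- At an active position of t the letter is p, whose label differs from v. The other word has a
    -- letter with the same label there; as fixed letters are labelled v, that letter is p′.
    off-label : ∀ {t p t′ p′} → t ∈ family → p ∈ P → t′ ∈ family → p′ ∈ P →
      positions t p ≡ positions t′ p′ → proj₂ p ≢ v → proj₂ p ≡ proj₂ p′
    off-label {t} {p} {t′} {p′} t∈ p∈ t′∈ p′∈ eq p≢v with m , act ← proj₂ (family-line t∈) =
      trans (sym label-p) (trans same (cong proj₂ (proj₂ (block-off t′∈ (λ e → p≢v (trans (sym label-p) (trans same e)))))))
      where
      label-p : proj₂ (block t p m) ≡ proj₂ p
      label-p = cong proj₂ (block-active t∈ act)
      same : proj₂ (block t p m) ≡ proj₂ (block t′ p′ m)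
      same = label-unique fP (block-∈ t∈ p∈ m) (block-∈ t′∈ p′∈ m)
        (trans (sym (position-block t p m)) (trans (cong (λ w → Vec.lookup w m) eq) (position-block t′ p′ m)))

    unique : ∀ {x x′} → View x → View x′ → proj₁ x ≡ proj₁ x′ → proj₂ x ≡ proj₂ x′
    unique (t , p , t∈ , p∈ , refl) (t′ , p′ , t′∈ , p′∈ , refl) eq
      with same ← horner-inj (positions-∈ t∈ p∈) (positions-∈ t′∈ p′∈) eq
      with proj₂ p ≟ v | proj₂ p′ ≟ v
    ... | yes e | yes e′ = trans e (sym e′)
    ... | no p≢v | _ = off-label t∈ p∈ t′∈ p′∈ same p≢v
    ... | yes _ | no p′≢v = sym (off-label t′∈ p′∈ t∈ p∈ (sym same) p′≢v)

    -- At each position the letters form a similar copy in P, so they coincide or their labels form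
    -- an edge. In the second case these are the labels of φ, unless an inactive letter stands in
    -- for a point not labelled v. Once such exceptions are excluded, either φ has an edge of labels
    -- or all positions are constant and its points coincide.
    project : (φ : Fin k → Point d × V) → (∀ i → View (φ i)) → Sim (proj₁ ∘ φ) →
      (∀ i j → proj₁ (φ i) ≡ proj₁ (φ j)) ⊎ Edge (proj₂ ∘ φ)
    project φ views sim = conclude (Fin-⊎ classify)
      where
      t : Fin k → Template (Point d × V) dim
      t i = proj₁ (views i)
      p : Fin k → Point d × V
      p i = proj₁ (proj₂ (views i))
      t∈ : ∀ i → t i ∈ family
      t∈ i = proj₁ (proj₂ (proj₂ (views i)))
      p∈ : ∀ i → p i ∈ P
      p∈ i = proj₁ (proj₂ (proj₂ (proj₂ (views i))))
      φ≡ : ∀ i → φ i ≡ place (t i) (p i)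
      φ≡ i = proj₂ (proj₂ (proj₂ (proj₂ (views i))))
      β : Fin dim → Fin k → Point d × V
      β m i = block (t i) (p i) m
      label : Fin k → V
      label i = proj₂ (p i)

      Constant Exceptional : Fin dim → Set
      Constant m = ∀ i j → proj₁ (β m i) ≡ proj₁ (β m j)
      Exceptional m = Edge (proj₂ ∘ β m) × ∃ λ i → ¬ Active (t i) m × label i ≢ v

      block-project : ∀ m → Constant m ⊎ Edge (proj₂ ∘ β m)
      block-project m = copies-project fP (β m) (λ i → block-∈ (t∈ i) (p∈ i) m)
        (Sim-cong (λ i → position-block (t i) (p i) m)
          (sims (λ i → positions (t i) (p i)) (λ i → positions-∈ (t∈ i) (p∈ i))
            (Sim-cong (cong proj₁ ∘ φ≡) sim) m))

      classify : ∀ m → Edge label ⊎ (Exceptional m ⊎ Constant m)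
      classify m with block-project m
      ... | inj₁ const = inj₂ (inj₂ const)
      ... | inj₂ edge with Fin-⊎ (λ i → good i)
        where
        good : ∀ i → (¬ Active (t i) m × label i ≢ v) ⊎ proj₂ (β m i) ≡ label i
        good i with nothing? (Vec.lookup (t i) m) | label i ≟ v
        ... | yes act | _ = inj₂ (cong proj₂ (block-active (t∈ i) act))
        ... | no inactive | yes e = inj₂ (trans (block-label (t∈ i) inactive) (sym e))
        ... | no inactive | no ≢v = inj₁ (inactive , ≢v)
      ...   | inj₁ exception = inj₂ (inj₁ (edge , exception))
      ...   | inj₂ agree = inj₁ (Edge-cong agree edge)

      -- The active positions of the k templates would form an almost-cover.
      no-exception : (∀ m → Exceptional m ⊎ Constant m) → ∀ m → ¬ Exceptional m
      no-exception cases m₀ (edge₀ , z₀ , inactive₀ , z₀≢v) = no-almost-cover 3≤k t t∈ cover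
        where
        -- Inactive letters are labelled v and an edge has distinct labels, so only one template can
        -- be inactive at m.
        others : ∀ {m z} → Edge (proj₂ ∘ β m) → ¬ Active (t z) m → ∀ i → i ≢ z → Active (t i) m × β m i ≡ p i
        others edge inactive i i≢z = block-off (t∈ i) λ e →
          Edge-distinct edge i≢z (trans e (sym (block-label (t∈ _) inactive)))
        off : ∀ i → label i ≢ v
        off i e with i FinP.≟ z₀
        ... | yes refl = z₀≢v e
        ... | no i≢z = Edge-distinct edge₀ i≢z
          (trans (cong proj₂ (proj₂ (others edge₀ inactive₀ i i≢z))) (trans e (sym (block-label (t∈ z₀) inactive₀))))
        cover : AlmostCover t
        cover m with cases m
        ... | inj₁ (edge , z , inactive , _) = inj₂ (z , inactive , λ i i≢z → proj₁ (others edge inactive i i≢z))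
        -- A template active here would force all labels to be equal, but the edge at m₀ shows two
        -- different labels at indices other than z₀.
        ... | inj₂ const = inj₁ λ j act → clash (labels-equal j act)
          where
          same : ∀ i j → proj₂ (β m i) ≡ proj₂ (β m j)
          same i j = label-unique fP (block-∈ (t∈ i) (p∈ i) m) (block-∈ (t∈ j) (p∈ j) m) (const i j)
          labels-equal : ∀ j → Active (t j) m → ∀ i → label i ≡ label j
          labels-equal j act i = trans (sym (cong proj₂ (proj₂ (block-off (t∈ i) λ e →
              off j (trans (sym at-j) (trans (same j i) e))))))
            (trans (same i j) at-j)
            where
            at-j : proj₂ (β m j) ≡ label j
            at-j = cong proj₂ (block-active (t∈ j) act)
          clash : ∀ {u} → ¬ (∀ i → label i ≡ u)
          clash all-u
            with x , x≢z , _ ← third 3≤k z₀ z₀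
            with y , y≢z , y≢x ← third 3≤k z₀ x =
            Edge-distinct edge₀ y≢x (trans (value y y≢z) (sym (value x x≢z)))
            where
            value : ∀ i → i ≢ z₀ → proj₂ (β m₀ i) ≡ _
            value i i≢z = trans (cong proj₂ (proj₂ (others edge₀ inactive₀ i i≢z))) (all-u i)

      conclude : ∃ (λ (m : Fin dim) → Edge label) ⊎ (∀ m → Exceptional m ⊎ Constant m) →
        (∀ i j → proj₁ (φ i) ≡ proj₁ (φ j)) ⊎ Edge (proj₂ ∘ φ)
      conclude (inj₁ (_ , edge)) = inj₂ (Edge-cong (sym ∘ cong proj₂ ∘ φ≡) edge)
      conclude (inj₂ cases) = inj₁ λ i j → trans (cong proj₁ (φ≡ i))
        (trans (cong (horner ls) (equal i j)) (sym (cong proj₁ (φ≡ j))))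
        where
        constant-block : ∀ m → Constant m
        constant-block m with cases m
        ... | inj₁ exc = contradiction exc (no-exception cases m)
        ... | inj₂ const = const
        equal : ∀ i j → positions (t i) (p i) ≡ positions (t j) (p j)
        equal i j = lookup-ext (λ m → trans (position-block (t i) (p i) m)
          (trans (constant-block m i j) (sym (position-block (t j) (p j) m))))
          where
          lookup-ext : ∀ {n} {w w′ : Vec (Point d) n} → (∀ m → Vec.lookup w m ≡ Vec.lookup w′ m) → w ≡ w′
          lookup-ext {w = []} {[]} _ = refl
          lookup-ext {w = _ ∷ _} {_ ∷ _} eq = cong₂ _∷_ (eq zero) (lookup-ext (λ m → eq (suc m)))

    monochromatic′ : (c : Point d × V → Fin (suc r)) → Σ (Homothety d) λ h → Embeds h P Q ×
        Σ (Fin (suc r)) λ κ → ∀ {p} → p ∈ P → proj₂ p ≡ v → c (move h p) ≡ κ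
    monochromatic′ c
      with t , t∈ , mono ← ramsey (λ w → c (horner ls (Vec.map proj₁ w) , v))
      with o , w , 1≤w , eq ← affine ls 1≤ls t =
      homothety o w (1≤w (proj₂ (family-line t∈))) ,
      (λ {p} p∈ → subst (_∈ Q) (cong (_, proj₂ p) (eq p)) (∈-cartesianProductWith⁺ place t∈ p∈)) ,
      c (horner ls (positions t q₀) , v) ,
      λ { {x , _} p∈ refl → trans (cong (λ y → c (y , v)) (sym (eq (x , v)))) (mono (complete p∈ refl) (here refl)) }

  amalgamate : ∀ {P} → Faithful P → (v : V) (r : ℕ) → Amalgam P v r
  amalgamate {P} fP v r = amalgamate-over fP v r (List.filter (λ p → proj₂ p ≟ v) P)
    (∈-filter⁻ (λ p → proj₂ p ≟ v)) (∈-filter⁺ (λ p → proj₂ p ≟ v))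

  -- For labels in `vs` the colour on the embedded copy depends on the label only, so a Ramsey
  -- theorem for labels can be applied.
  record Partite (P : Picture) (vs : List V) (r : ℕ) : Set where
    field
      picture : Picture
      faithful : Faithful picture
      labels : ∀ {p} → p ∈ picture → ∃ λ q → q ∈ P × proj₂ p ≡ proj₂ q
      label-coloured : (c : Point d × V → Fin (suc r)) → Σ (Homothety d) λ h → Embeds h P picture ×
        Σ (V → Fin (suc r)) λ γ → ∀ {p} → p ∈ P → proj₂ p ∈ vs → c (move h p) ≡ γ (proj₂ p)

  -- The label v is amalgamated first, the others around it. A colouring is reduced in the opposite
  -- order: g settles `vs`, then h finds inside a copy on which v is monochromatic too; the colours
  -- given by γ persist there.
  partite : ∀ {P} → Faithful P → (vs : List V) (r : ℕ) → Partite P vs r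
  partite {P} fP [] r = record
    { picture = P ; faithful = fP ; labels = λ p∈ → _ , p∈ , refl
    ; label-coloured = λ c → identity ,
        (λ {p} p∈ → subst (_∈ P) (cong (_, proj₂ p) (sym (apply-identity (proj₁ p)))) p∈) , (λ _ → zero) , λ _ () }
  partite {P} fP (v ∷ vs) r = record
    { picture = picture ; faithful = faithful
    ; labels = λ p∈ → let q , q∈ , e = labels p∈ ; q′ , q′∈ , e′ = Amalgam.labels am q∈ in q′ , q′∈ , trans e e′
    ; label-coloured = coloured }
    where
    am = amalgamate fP v r
    open Partite (partite (Amalgam.faithful am) vs r)
    coloured : (c : Point d × V → Fin (suc r)) → Σ (Homothety d) λ h → Embeds h P picture ×
        Σ (V → Fin (suc r)) λ γ → ∀ {p} → p ∈ P → proj₂ p ∈ v ∷ vs → c (move h p) ≡ γ (proj₂ p)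
    coloured c
      with g , g-embeds , γ , γ-colour ← label-coloured c
      with h , h-embeds , κ , κ-colour ← Amalgam.monochromatic am (c ∘ move g) =
      g ∘ₕ h , (λ {p} p∈ → subst (_∈ picture) (sym (move-∘ p)) (g-embeds (h-embeds p∈))) , γ′ , colour
      where
      move-∘ : ∀ p → move (g ∘ₕ h) p ≡ move g (move h p)
      move-∘ (x , w) = cong (_, w) (apply-∘ₕ g h x)
      γ′ : V → Fin (suc r)
      γ′ w with w ≟ v
      ... | yes _ = κ
      ... | no _ = γ w
      colour : ∀ {p} → p ∈ P → proj₂ p ∈ v ∷ vs → c (move (g ∘ₕ h) p) ≡ γ′ (proj₂ p)
      colour {p} p∈ l∈ rewrite move-∘ p with proj₂ p ≟ v
      ... | yes e = κ-colour p∈ e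
      ... | no ≢v with l∈
      ...   | here e = contradiction e ≢v
      ...   | there l∈vs = γ-colour (h-embeds p∈) l∈vs

-- The shift hypergraph: chromatic number

Vertex : Set
Vertex = List ℕ

Below : ℕ → Vertex → Set
Below b [] = ⊤
Below b (x ∷ xs) = x < b × Below x xs

below? : ∀ b xs → Dec (Below b xs)
below? b [] = yes tt
below? b (x ∷ xs) = (x ℕP.<? b) ×-dec below? x xs

dropLast : Vertex → Vertex
dropLast [] = []
dropLast (x ∷ []) = []
dropLast (x ∷ y ∷ ys) = x ∷ dropLast (y ∷ ys)

below-dropLast : ∀ {b} xs → Below b xs → Below b (dropLast xs)
below-dropLast [] _ = tt
below-dropLast (x ∷ []) _ = tt
below-dropLast (x ∷ y ∷ ys) (x<b , rest) = x<b , below-dropLast (y ∷ ys) rest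

length-dropLast : ∀ x xs → length (dropLast (x ∷ xs)) ≡ length xs
length-dropLast x [] = refl
length-dropLast x (y ∷ ys) = cong suc (length-dropLast y ys)

-- A and B are the first and the last |B| entries of a decreasing sequence of length 1 + |B|.
Shift : Vertex → Vertex → Set
Shift [] B = ⊥
Shift (x ∷ D) B = D ≡ dropLast B × Below x B

shift? : ∀ A B → Dec (Shift A B)
shift? [] B = no λ ()
shift? (x ∷ D) B = ListP.≡-dec ℕP._≟_ D (dropLast B) ×-dec below? x B

-- Windows are listed from the end of the decreasing sequence to its beginning, so their heads
-- increase along the vector.
Path : ∀ {n} → Vec Vertex n → Set
Path [] = ⊤
Path (B ∷ []) = ⊤
Path (B ∷ A ∷ As) = Shift A B × Path (A ∷ As)

path? : ∀ {n} (As : Vec Vertex n) → Dec (Path As)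
path? [] = yes tt
path? (B ∷ []) = yes tt
path? (B ∷ A ∷ As) = shift? A B ×-dec path? (A ∷ As)

height : Vertex → ℕ
height [] = 0
height (x ∷ _) = suc x

shift-height : ∀ A B → Shift A B → height B < height A
shift-height (x ∷ D) [] _ = s≤s z≤n
shift-height (x ∷ D) (y ∷ _) (_ , y<x , _) = s≤s y<x

path-heights : ∀ {n} B (As : Vec Vertex n) → Path (B ∷ As) → ∀ i → height B < height (Vec.lookup As i)
path-heights B (A ∷ As) (s , path) zero = shift-height A B s
path-heights B (A ∷ As) (s , path) (suc i) = ℕP.<-trans (shift-height A B s) (path-heights A As path i)

path-tail : ∀ {n} B (As : Vec Vertex n) → Path (B ∷ As) → Path As
path-tail B [] _ = tt
path-tail B (A ∷ As) (_ , path) = path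

path-injective : ∀ {n} (As : Vec Vertex n) → Path As → ∀ i j → Vec.lookup As i ≡ Vec.lookup As j → i ≡ j
path-injective (A ∷ As) path zero zero _ = refl
path-injective (A ∷ As) path zero (suc j) eq = contradiction (path-heights A As path j) (ℕP.<-irrefl (cong height eq))
path-injective (A ∷ As) path (suc i) zero eq = contradiction (path-heights A As path i) (ℕP.<-irrefl (cong height (sym eq)))
path-injective (A ∷ As) path (suc i) (suc j) eq = cong suc (path-injective As (path-tail A As path) i j eq)

bit : ∀ {P : Set} → Dec P → Fin 2
bit (yes _) = suc zero
bit (no _) = zero

bit-transfer : ∀ {P Q : Set} (p? : Dec P) (q? : Dec Q) → bit p? ≡ bit q? → P → Q
bit-transfer _ (yes q) _ _ = q
bit-transfer (no ¬p) (no _) _ p = contradiction p ¬p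

bits-transfer : ∀ {n} {P Q : Fin n → Set} (p? : ∀ i → Dec (P i)) (q? : ∀ i → Dec (Q i)) →
  Fin.funToFin (λ i → bit (p? i)) ≡ Fin.funToFin (λ i → bit (q? i)) → ∀ i → P i → Q i
bits-transfer p? q? eq i = bit-transfer (p? i) (q? i)
  (trans (sym (FinP.finToFun-funToFin (λ i → bit (p? i)) i))
    (trans (cong (λ z → Fin.finToFun z i) eq) (FinP.finToFun-funToFin (λ i → bit (q? i)) i)))

record ShiftPair (N m : ℕ) {r : ℕ} (c : Vertex → Fin r) : Set where
  constructor shiftPair
  field
    first : ℕ
    rest : Vertex
    below : Below N (first ∷ rest)
    size : length rest ≡ m
    same : c (first ∷ dropLast rest) ≡ c rest

-- Induction on m: colour an m-tuple B by the set of colours of its extensions x ∷ B.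
shift-ramsey : ∀ m r → Σ ℕ λ N → (c : Vertex → Fin r) → ShiftPair N (suc m) c
shift-ramsey zero r = suc r , pair
  where
  pair : (c : Vertex → Fin r) → ShiftPair (suc r) 1 c
  pair c with i , j , i<j , eq ← FinP.pigeonhole (ℕP.n<1+n r) (λ i → c (Fin.toℕ i ∷ [])) =
    shiftPair (Fin.toℕ j) (Fin.toℕ i ∷ []) (FinP.toℕ<n j , i<j , tt) refl (sym eq)
shift-ramsey (suc m) r = N , pair
  where
  IH = shift-ramsey m (2 ^ r)
  N = proj₁ IH
  module _ (c : Vertex → Fin r) where
    Extension : Vertex → Fin r → Set
    Extension B j = ∃ λ x → x < N × (Below x B × c (x ∷ B) ≡ j)
    extension? : ∀ B j → Dec (Extension B j)
    extension? B j = ℕP.anyUpTo? (λ x → below? x B ×-dec (c (x ∷ B) FinP.≟ j)) N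
    pair : ShiftPair N (suc (suc m)) c
    pair with proj₂ IH (λ B → Fin.funToFin (λ j → bit (extension? B j)))
    ... | shiftPair x (y ∷ B) (x<N , below) size same
      -- The colour of `x ∷ y ∷ B` comes from an extension of `y ∷ B`, hence also from an extension
      -- of `x ∷ dropLast (y ∷ B)` by some z, both having the same set of colours.
      with z , z<N , below′ , eq ← bits-transfer (extension? (y ∷ B)) (extension? (x ∷ dropLast (y ∷ B))) (sym same)
             (c (x ∷ y ∷ B)) (x , x<N , below , refl) =
      shiftPair z (x ∷ y ∷ B) (z<N , proj₁ below′ , below) (cong suc size) eq

InRange : ℕ → ℕ → Vertex → Set
InRange N m A = Below N A × length A ≡ m

module _ {r : ℕ} (N : ℕ) (c : Vertex → Fin r) where

  Chain : ℕ → Vertex → Set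
  Chain zero A = ⊤
  Chain (suc n) A = ∃ λ x → x < N × (Below x A × c (x ∷ dropLast A) ≡ c A × Chain n (x ∷ dropLast A))

  chain? : ∀ n A → Dec (Chain n A)
  chain? zero A = yes tt
  chain? (suc n) A = ℕP.anyUpTo? (λ x → below? x A ×-dec (c (x ∷ dropLast A) FinP.≟ c A) ×-dec chain? n (x ∷ dropLast A)) N

  chain-path : ∀ {m} n A → InRange N (suc m) A → Chain n A → Σ (Vec Vertex n) λ As → Path (A ∷ As) ×
    VAll.All (InRange N (suc m)) (A ∷ As) × VAll.All (λ B → c B ≡ c A) As
  chain-path zero A range _ = [] , tt , range ∷ [] , []
  chain-path {m} (suc n) A@(y ∷ B) (below , size) (x , x<N , x-below , eq , chain)
    with As , path , ranges , colours ← chain-path n (x ∷ dropLast A)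
      ((x<N , below-dropLast A x-below) , cong suc (trans (length-dropLast y B) (ℕP.suc-injective size))) chain =
    _ ∷ As , ((refl , x-below) , path) , (below , size) ∷ ranges , eq ∷ VAll.map (λ e → trans e eq) colours

-- The colour of A is refined by recording for which n ≤ k it starts a chain of n further windows of
-- its colour. Some consecutive windows B and A₀ have equal refined colours. A chain of length n < k
-- from B yields one from A₀, hence one of length n + 1 from B; so B starts a chain of length k.
path-ramsey : ∀ m r k → Σ ℕ λ N → (c : Vertex → Fin r) → Σ (Vec Vertex (suc k)) λ As → Path As ×
  VAll.All (InRange N (suc m)) As × Σ (Fin r) λ j → VAll.All (λ B → c B ≡ j) As
path-ramsey m r k = N , found
  where
  R = shift-ramsey m (r * 2 ^ suc k)
  N = proj₁ R
  found : (c : Vertex → Fin r) → Σ (Vec Vertex (suc k)) λ As → Path As ×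
    VAll.All (InRange N (suc m)) As × Σ (Fin r) λ j → VAll.All (λ B → c B ≡ j) As
  found c
    with shiftPair x B (x<N , below) size same ← proj₂ R
      (λ A → Fin.combine (c A) (Fin.funToFin (λ (n : Fin (suc k)) → bit (chain? N c (Fin.toℕ n) A)))) =
    let As , path , ranges , colours = chain-path N c k B (weaken B below , size) (long k ℕP.≤-refl)
    in B ∷ As , path , ranges , c B , refl ∷ colours
    where
    A₀ = x ∷ dropLast B
    same-parts = FinP.combine-injective (c A₀) _ (c B) _ same
    weaken : ∀ B → Below x B → Below N B
    weaken [] _ = tt
    weaken (y ∷ _) (y<x , rest) = ℕP.<-trans y<x x<N , rest
    long : ∀ n → n ≤ k → Chain N c n B
    long zero _ = tt
    long (suc n) n<k = x , x<N , below , proj₁ same-parts , subst (λ n → Chain N c n A₀) (FinP.toℕ-fromℕ< n<sk)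
      (bits-transfer (λ i → chain? N c (Fin.toℕ i) B) (λ i → chain? N c (Fin.toℕ i) A₀) (sym (proj₂ same-parts)) (Fin.fromℕ< n<sk)
        (subst (λ n → Chain N c n B) (sym (FinP.toℕ-fromℕ< n<sk)) (long n (ℕP.<⇒≤ n<k))))
      where
      n<sk : n < suc k
      n<sk = ℕP.m<n⇒m<1+n n<k

-- The shift hypergraph: large edge-free sets

Marking : Set
Marking = ℕ → Bool

indicator : Bool → ℕ
indicator true = 1
indicator false = 0

mark : ℕ → Bool → Marking → Marking
mark n b τ x with x ℕP.≟ n
... | yes _ = b
... | no _ = τ x

mark-self : ∀ n b τ → mark n b τ n ≡ b
mark-self n b τ with n ℕP.≟ n
... | yes _ = refl
... | no n≢n = contradiction refl n≢n

mark-other : ∀ {n x} b τ → x < n → mark n b τ x ≡ τ x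
mark-other {n} {x} b τ x<n with x ℕP.≟ n
... | yes refl = contradiction x<n (ℕP.<-irrefl refl)
... | no _ = refl

-- Normalised by (1 + l) ^ N this is the expectation when each x < N is marked independently
-- with probability 1 / (1 + l).
module Average (l : ℕ) where

  W : ℕ → (Marking → ℕ) → ℕ
  W zero f = f (λ _ → false)
  W (suc N) f = W N (λ τ → f (mark N true τ)) + l * W N (λ τ → f (mark N false τ))

  W-cong : ∀ N {f g} → (∀ τ → f τ ≡ g τ) → W N f ≡ W N g
  W-cong zero eq = eq _
  W-cong (suc N) eq = cong₂ (λ x y → x + l * y) (W-cong N (λ τ → eq _)) (W-cong N (λ τ → eq _))

  W-+ : ∀ N f g → W N (λ τ → f τ + g τ) ≡ W N f + W N g
  W-+ zero f g = refl
  W-+ (suc N) f g = trans (cong₂ (λ x y → x + l * y) (W-+ N _ _) (W-+ N _ _))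
    (lemma l (W N (λ τ → f (mark N true τ))) (W N (λ τ → g (mark N true τ)))
      (W N (λ τ → f (mark N false τ))) (W N (λ τ → g (mark N false τ))))
    where
    lemma : ∀ l a b c d → a + b + l * (c + d) ≡ a + l * c + (b + l * d)
    lemma = ℕSolver.solve-∀

  W-const : ∀ N c → W N (λ _ → c) ≡ suc l ^ N * c
  W-const zero c = sym (ℕP.*-identityˡ c)
  W-const (suc N) c = trans (cong₂ (λ x y → x + l * y) (W-const N c) (W-const N c)) (lemma l (suc l ^ N) c)
    where
    lemma : ∀ l p c → p * c + l * (p * c) ≡ (suc l * p) * c
    lemma = ℕSolver.solve-∀

  W-attained : ∀ N f → ∃ λ τ → W N f ≤ suc l ^ N * f τ
  W-attained zero f = (λ _ → false) , ℕP.≤-reflexive (sym (ℕP.*-identityˡ _))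
  W-attained (suc N) f
    with τ₁ , le₁ ← W-attained N (λ τ → f (mark N true τ)) | τ₀ , le₀ ← W-attained N (λ τ → f (mark N false τ)) =
    choose (ℕP.≤-total (f (mark N true τ₁)) (f (mark N false τ₀)))
    where
    p = suc l ^ N
    bound : ∀ {z} → f (mark N true τ₁) ≤ z → f (mark N false τ₀) ≤ z → W (suc N) f ≤ suc l ^ suc N * z
    bound {z} x≤z y≤z = ℕP.≤-trans
      (ℕP.+-mono-≤ (ℕP.≤-trans le₁ (ℕP.*-monoʳ-≤ p x≤z)) (ℕP.*-monoʳ-≤ l (ℕP.≤-trans le₀ (ℕP.*-monoʳ-≤ p y≤z))))
      (ℕP.≤-reflexive (lemma l p z))
      where
      lemma : ∀ l p z → p * z + l * (p * z) ≡ (suc l * p) * z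
      lemma = ℕSolver.solve-∀
    choose : _ → ∃ λ τ → W (suc N) f ≤ suc l ^ suc N * f τ
    choose (inj₁ x≤y) = mark N false τ₀ , bound x≤y ℕP.≤-refl
    choose (inj₂ y≤x) = mark N true τ₁ , bound ℕP.≤-refl y≤x

injective⇒surjective : ∀ {n} (σ : Fin n → Fin n) → (∀ {i j} → σ i ≡ σ j → i ≡ j) → ∀ j → ∃ λ i → σ i ≡ j
injective⇒surjective {suc n} σ σ-inj j with FinP.any? (λ i → σ i FinP.≟ j)
... | yes hit = hit
... | no miss = contradiction
  (FinP.injective⇒≤ {f = λ i → Fin.punchOut (j≢ i)} λ {x} {y} eq → σ-inj (FinP.punchOut-injective (j≢ x) (j≢ y) eq))
  ℕP.1+n≰n
  where
  j≢ : ∀ i → j ≢ σ i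
  j≢ i e = miss (i , sym e)

-- Cyclic counters: no edge is kept completely.

module Cyclic (K : ℕ) where

  next : ℕ → ℕ
  next u with u ℕP.≟ K
  ... | yes _ = 0
  ... | no _ = suc u

  accept : ℕ → Bool
  accept u with u ℕP.≟ K
  ... | yes _ = false
  ... | no _ = true

  next-K : next K ≡ 0
  next-K with K ℕP.≟ K
  ... | yes _ = refl
  ... | no K≢K = contradiction refl K≢K

  next-< : ∀ {u} → u < K → next u ≡ suc u
  next-< {u} u<K with u ℕP.≟ K
  ... | yes refl = contradiction u<K (ℕP.<-irrefl refl)
  ... | no _ = refl

  accept-K : accept K ≡ false
  accept-K with K ℕP.≟ K
  ... | yes _ = refl
  ... | no K≢K = contradiction refl K≢K

  -- Read A from its largest entry on, with a counter modulo K + 1 started at u, and accept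
  -- if the counter differs from K at the first marked entry.
  good : Marking → ℕ → Vertex → Bool
  good τ u [] = false
  good τ u (x ∷ xs) = if τ x then accept u else good τ (next u) xs

  -- With start value K the counter at position p is p - 1 modulo K + 1, so a first mark is rejected
  -- exactly at the multiples of K + 1.
  Good : Marking → ℕ → Vertex → Set
  Good τ u A = good τ u A ≡ true

  good-dropLast : ∀ τ u A → Good τ u (dropLast A) → Good τ u A
  good-dropLast τ u (x ∷ xs) = cons u x xs
    where
    cons : ∀ u x xs → Good τ u (dropLast (x ∷ xs)) → Good τ u (x ∷ xs)
    cons u x (y ∷ ys) g with τ x
    ... | true = g
    ... | false = cons (next u) y ys g

  -- If the head of A were marked, A would be rejected from K. So it is unmarked, and what remains,
  -- read from `next u`, is B without its last entry.
  shift-good : ∀ τ A B → Shift A B → Good τ K A → ∀ {u} → Good τ u A → Good τ (next u) B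
  shift-good τ (x ∷ _) B (refl , _) gK g with τ x
  ... | true = contradiction (trans (sym accept-K) gK) λ ()
  ... | false = good-dropLast τ _ B g

  -- The window following B in the vector is good from K, so B is good from 0; if that window is
  -- good from j, then B is good from j + 1.
  path-good : ∀ τ {n} B (As : Vec Vertex n) → Path (B ∷ As) → VAll.All (Good τ K) As → n ≤ K →
    ∀ {j} → j < n → Good τ j B
  path-good τ B (A ∷ As) (s , path) (gA ∷ gAs) n≤K {zero} _ = subst (λ u → Good τ u B) next-K (shift-good τ A B s gA gA)
  path-good τ B (A ∷ As) (s , path) (gA ∷ gAs) n≤K {suc j} (s≤s j<n) =
    subst (λ u → Good τ u B) (next-< (ℕP.≤-trans (s≤s (ℕP.<⇒≤ j<n)) n≤K))
      (shift-good τ A B s gA (path-good τ A As path gAs (ℕP.<⇒≤ n≤K) j<n))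

  -- The start values are permuted by `next`, so one of them meets the first mark with counter K;
  -- without a mark nothing is good.
  not-all-good : ∀ τ A → ¬ (∀ u → u ≤ K → Good τ u A)
  not-all-good τ [] g with () ← g 0 z≤n
  not-all-good τ (x ∷ xs) g with τ x
  ... | true = contradiction (trans (sym accept-K) (g K ℕP.≤-refl)) λ ()
  ... | false = not-all-good τ xs λ
    { zero _ → subst (λ u → Good τ u xs) next-K (g K ℕP.≤-refl)
    ; (suc u) u<K → subst (λ u → Good τ u xs) (next-< u<K) (g u (ℕP.<⇒≤ u<K)) }

  path-not-good : ∀ τ (As : Vec Vertex (suc K)) → Path As → ¬ VAll.All (Good τ K) As
  path-not-good τ (B ∷ As) path (gB ∷ gAs) = not-all-good τ B λ u u≤K → states u (ℕP.m≤n⇒m<n∨m≡n u≤K)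
    where
    states : ∀ u → u < K ⊎ u ≡ K → Good τ u B
    states u (inj₁ u<K) = path-good τ B As path gAs ℕP.≤-refl u<K
    states u (inj₂ refl) = gB

  -- The order of the windows is left open, since a similar copy of F within F may permute its
  -- points.
  Edge : (Fin (suc K) → Vertex) → Set
  Edge f = Σ (Vec Vertex (suc K)) λ As → Path As × Σ (Fin (suc K) → Fin (suc K)) λ σ →
    (∀ {i j} → σ i ≡ σ j → i ≡ j) × (∀ i → f i ≡ Vec.lookup As (σ i))

  Edge-cong : ∀ {f g} → (∀ i → f i ≡ g i) → Edge f → Edge g
  Edge-cong eq (As , path , σ , σ-inj , f≡) = As , path , σ , σ-inj , λ i → trans (sym (eq i)) (f≡ i)

  Edge-distinct : ∀ {f} → Edge f → ∀ {i j} → i ≢ j → f i ≢ f j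
  Edge-distinct (As , path , σ , σ-inj , f≡) {i} {j} i≢j eq =
    i≢j (σ-inj (path-injective As path (σ i) (σ j) (trans (sym (f≡ i)) (trans eq (f≡ j)))))

  Edge-not-good : ∀ τ {f} → Edge f → ¬ (∀ i → Good τ K (f i))
  Edge-not-good τ (As , path , σ , σ-inj , f≡) g = path-not-good τ As path (VAllP.lookup⁻ at)
    where
    at : ∀ j → Good τ K (Vec.lookup As j)
    at j with i , refl ← injective⇒surjective σ σ-inj j = subst (Good τ K) (f≡ i) (g i)

  good-local : ∀ {N} τ b u A → Below N A → good (mark N b τ) u A ≡ good τ u A
  good-local τ b u [] _ = refl
  good-local {N} τ b u (x ∷ xs) (x<N , below) rewrite mark-other b τ x<N =
    cong (if τ x then accept u else_) (good-local τ b (next u) xs (widen xs below))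
    where
    widen : ∀ xs → Below x xs → Below N xs
    widen [] _ = tt
    widen (y ∷ _) (y<x , rest) = ℕP.<-trans y<x x<N , rest

  -- Counting the accepted vertices.

  module Count (l : ℕ) where
    open Average l

    L = suc l

    bad : ℕ → Vertex → Marking → ℕ
    bad u A τ = indicator (not (good τ u A))

    -- Divided by L ^ n, this is the probability that n entries, each marked with probability 1 / L,
    -- are rejected from counter u; having no mark counts as rejection.
    rejected : ℕ → ℕ → ℕ
    rejected u zero = 1
    rejected u (suc n) = L ^ n * indicator (not (accept u)) + l * rejected (next u) n

    -- The entries of A are distinct, so their marks are independent. The marks are exposed from the
    -- largest number down.
    W-bad : ∀ N u A → Below N A → W N (bad u A) * L ^ length A ≡ L ^ N * rejected u (length A)
    W-bad N u [] _ = trans (ℕP.*-identityʳ _) (W-const N 1)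
    W-bad (suc N) u A@(x ∷ xs) (x<1+N , below) with ℕP.m≤n⇒m<n∨m≡n (ℕP.≤-pred x<1+N)
    ... | inj₂ refl = trans (cong (_* L ^ length A) split)
          (trans (lemma l p e w q) (trans (cong (λ z → L * (p * (q * e) + l * z)) (W-bad N (next u) xs below))
            (lemma′ l p e q (rejected (next u) (length xs)))))
      where
      p = L ^ N
      q = L ^ length xs
      e = indicator (not (accept u))
      w = W N (bad (next u) xs)
      marked : ∀ τ → bad u A (mark N true τ) ≡ e
      marked τ rewrite mark-self N true τ = refl
      unmarked : ∀ τ → bad u A (mark N false τ) ≡ bad (next u) xs τ
      unmarked τ rewrite mark-self N false τ = cong (λ b → indicator (not b)) (good-local τ false (next u) xs below)
      split : W (suc N) (bad u A) ≡ p * e + l * w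
      split = cong₂ (λ a b → a + l * b) (trans (W-cong N marked) (W-const N e)) (W-cong N unmarked)
      lemma : ∀ l p e w q → (p * e + l * w) * (suc l * q) ≡ suc l * (p * (q * e) + l * (w * q))
      lemma = ℕSolver.solve-∀
      lemma′ : ∀ l p e q z → suc l * (p * (q * e) + l * (p * z)) ≡ suc l * p * (q * e + l * z)
      lemma′ = ℕSolver.solve-∀
    ... | inj₁ x<N = trans (cong (_* L ^ length A) split)
          (trans (ℕP.*-assoc L (W N (bad u A)) (L ^ length A))
            (trans (cong (L *_) (W-bad N u A below′)) (sym (ℕP.*-assoc L (L ^ N) (rejected u (length A))))))
      where
      below′ : Below N A
      below′ = x<N , below
      same : ∀ b τ → bad u A (mark N b τ) ≡ bad u A τ
      same b τ = cong (λ b → indicator (not b)) (good-local τ b u A below′)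
      split : W (suc N) (bad u A) ≡ L * W N (bad u A)
      split = cong₂ (λ a b → a + l * b) (W-cong N (same true)) (W-cong N (same false))

    k = suc K

    -- As a probability the bound is (L + u) / (k L) + (l / L)^n. The first summand satisfies the
    -- recursion exactly at u = K and with slack below; the second pays for tuples without marks.
    rejected-bound : ∀ n u → u ≤ K → k * L * rejected u n ≤ L ^ n * (L + u) + k * L * l ^ n
    rejected-bound zero u _ = ℕP.m≤n+m (k * L * 1) (1 * (L + u))
    rejected-bound (suc n) u u≤K with u ℕP.≟ K
    ... | yes refl = ℕP.≤-trans (ℕP.≤-reflexive (lemma l K (L ^ n) (rejected 0 n)))
          (ℕP.≤-trans (ℕP.+-monoʳ-≤ (k * L * L ^ n) (ℕP.*-monoʳ-≤ l (rejected-bound n 0 z≤n)))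
            (ℕP.≤-reflexive (lemma′ l K (L ^ n) (l ^ n))))
      where
      lemma : ∀ l K p z → suc K * suc l * (p * 1 + l * z) ≡ suc K * suc l * p + l * (suc K * suc l * z)
      lemma = ℕSolver.solve-∀
      lemma′ : ∀ l K p z → suc K * suc l * p + l * (p * (suc l + 0) + suc K * suc l * z) ≡
        (suc l * p) * (suc l + K) + suc K * suc l * (l * z)
      lemma′ = ℕSolver.solve-∀
    ... | no u≢K = ℕP.≤-trans (ℕP.≤-reflexive (lemma l K (L ^ n) (rejected (suc u) n)))
          (ℕP.≤-trans (ℕP.*-monoʳ-≤ l (rejected-bound n (suc u) (ℕP.≤∧≢⇒< u≤K u≢K)))
            (ℕP.≤-trans (ℕP.m≤m+n _ (L ^ n * suc u)) (ℕP.≤-reflexive (lemma′ l K (L ^ n) (l ^ n) u))))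
      where
      lemma : ∀ l K p z → suc K * suc l * (p * 0 + l * z) ≡ l * (suc K * suc l * z)
      lemma = ℕSolver.solve-∀
      lemma′ : ∀ l K p z u → l * (p * (suc l + suc u) + suc K * suc l * z) + p * suc u ≡
        (suc l * p) * (suc l + u) + suc K * suc l * (l * z)
      lemma′ = ℕSolver.solve-∀

    -- Bernoulli's inequality (L / l)^n ≥ 1 + n / L, cleared of denominators.
    bernoulli : ∀ n → l ^ n * (L + n) ≤ L ^ n * L
    bernoulli zero = ℕP.≤-reflexive (cong (1 *_) (ℕP.+-identityʳ L))
    bernoulli (suc n) = ℕP.≤-trans (ℕP.m≤m+n _ (l ^ n * suc n))
      (ℕP.≤-trans (ℕP.≤-reflexive (lemma l (l ^ n) n)) (ℕP.≤-trans (ℕP.*-monoʳ-≤ L (bernoulli n))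
        (ℕP.≤-reflexive (sym (ℕP.*-assoc L (L ^ n) L)))))
      where
      lemma : ∀ l p n → l * p * (suc l + suc n) + p * suc n ≡ suc l * (p * (suc l + n))
      lemma = ℕSolver.solve-∀

    -- This explains the length L * L of the vertices: all entries are unmarked with probability at
    -- most 1 / L.
    tail-bound : L * l ^ (L * L) ≤ L ^ (L * L)
    tail-bound = ℕP.*-cancelʳ-≤ (L * z) (L ^ (L * L)) L (ℕP.≤-trans (ℕP.m≤m+n _ (z * L))
      (ℕP.≤-trans (ℕP.≤-reflexive (lemma l z)) (bernoulli (L * L))))
      where
      z = l ^ (L * L)
      lemma : ∀ l z → suc l * z * suc l + z * suc l ≡ z * (suc l + suc l * suc l)
      lemma = ℕSolver.solve-∀

    -- Adding 1 / L from `tail-bound` to (L + K) / (k L) and rounding K up to k bounds the rejection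
    -- probability by 1 / k + 2 / L.
    W-bad-bound : ∀ N A → Below N A → length A ≡ L * L → k * L * W N (bad K A) ≤ L ^ N * (L + 2 * k)
    W-bad-bound N A below size≡ = ℕP.*-cancelʳ-≤ (k * L * w) (L ^ N * (L + 2 * k)) q {{ℕP.m^n≢0 L (L * L)}} (begin
      k * L * w * q            ≡⟨ ℕP.*-assoc (k * L) w q ⟩
      k * L * (w * q)          ≡⟨ cong (k * L *_) (subst (λ n → w * L ^ n ≡ L ^ N * rejected K n) size≡ (W-bad N K A below)) ⟩
      k * L * (L ^ N * b)      ≡⟨ swap (k * L) (L ^ N) b ⟩
      L ^ N * (k * L * b)      ≤⟨ ℕP.*-monoʳ-≤ (L ^ N) (rejected-bound (L * L) K ℕP.≤-refl) ⟩
      L ^ N * (q * (L + K) + k * L * l ^ (L * L)) ≤⟨ ℕP.*-monoʳ-≤ (L ^ N) (ℕP.+-monoʳ-≤ (q * (L + K))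
          (ℕP.≤-trans (ℕP.≤-reflexive (ℕP.*-assoc k L _)) (ℕP.*-monoʳ-≤ k tail-bound))) ⟩
      L ^ N * (q * (L + K) + k * q) ≤⟨ ℕP.m≤m+n _ (L ^ N * q) ⟩
      L ^ N * (q * (L + K) + k * q) + L ^ N * q ≡⟨ final (L ^ N) q L K ⟩
      L ^ N * (L + 2 * k) * q  ∎)
      where
      open ℕP.≤-Reasoning
      w = W N (bad K A)
      q = L ^ (L * L)
      b = rejected K (L * L)
      swap : ∀ a b c → a * (b * c) ≡ b * (a * c)
      swap = ℕSolver.solve-∀
      final : ∀ p q L K → p * (q * (L + K) + suc K * q) + p * q ≡ p * (L + 2 * suc K) * q
      final = ℕSolver.solve-∀

    -- For t > 0, `gap` says s / t ≤ 1 - 1 / k - 1 / (t k), and `large` makes the error 2 / L at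
    -- most 1 / (t k).
    W-good : ∀ N A s t → 2 * t * k ≤ L → s * k + suc t ≤ t * k → Below N A → length A ≡ L * L →
      s * L ^ N ≤ t * W N (λ τ → indicator (good τ K A))
    W-good N A s t large gap below size = ℕP.*-cancelʳ-≤ (s * p) (t * g) (k * L)
      (ℕP.+-cancelʳ-≤ (t * (k * L * w)) _ _ (begin
        s * p * (k * L) + t * (k * L * w)            ≤⟨ ℕP.+-monoʳ-≤ (s * p * (k * L)) (ℕP.*-monoʳ-≤ t (W-bad-bound N A below size)) ⟩
        s * p * (k * L) + t * (p * (L + 2 * k))      ≡⟨ regroup s p k L t ⟩
        p * (s * k * L + t * L + 2 * t * k)          ≤⟨ ℕP.*-monoʳ-≤ p (ℕP.+-monoʳ-≤ (s * k * L + t * L) large) ⟩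
        p * (s * k * L + t * L + L)                  ≡⟨ regroup′ s p k L t ⟩
        p * ((s * k + suc t) * L)                    ≤⟨ ℕP.*-monoʳ-≤ p (ℕP.*-monoˡ-≤ L gap) ⟩
        p * (t * k * L)                              ≡⟨ cong (_* (t * k * L)) (sym total) ⟩
        (g + w) * (t * k * L)                        ≡⟨ regroup″ g w t k L ⟩
        t * g * (k * L) + t * (k * L * w)            ∎))
      where
      open ℕP.≤-Reasoning
      p = L ^ N
      w = W N (bad K A)
      g = W N (λ τ → indicator (good τ K A))
      complement : ∀ b → indicator b + indicator (not b) ≡ 1
      complement true = refl
      complement false = refl
      total : g + w ≡ p
      total = trans (sym (W-+ N _ _)) (trans (W-cong N (λ τ → complement (good τ K A))) (trans (W-const N 1) (ℕP.*-identityʳ p)))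
      regroup : ∀ s p k L t → s * p * (k * L) + t * (p * (L + 2 * k)) ≡ p * (s * k * L + t * L + 2 * t * k)
      regroup = ℕSolver.solve-∀
      regroup′ : ∀ s p k L t → p * (s * k * L + t * L + L) ≡ p * ((s * k + suc t) * L)
      regroup′ = ℕSolver.solve-∀
      regroup″ : ∀ g w t k L → (g + w) * (t * k * L) ≡ t * g * (k * L) + t * (k * L * w)
      regroup″ = ℕSolver.solve-∀

    count : Marking → List Vertex → ℕ
    count τ [] = 0
    count τ (A ∷ As) = indicator (good τ K A) + count τ As

    -- By linearity of expectation the average count is large enough, and some marking reaches the
    -- average. Repeated vertices count with multiplicity.
    many-good : ∀ s t → 2 * t * k ≤ L → s * k + suc t ≤ t * k → (As : List Vertex) →
      LAll.All (λ A → ∃ λ N → InRange N (L * L) A) As → ∃ λ τ → s * length As ≤ t * count τ As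
    many-good s t large gap As ranges = τ , ℕP.*-cancelˡ-≤ (L ^ N) {{ℕP.m^n≢0 L N}} (begin
        L ^ N * (s * length As)            ≡⟨ swap (L ^ N) s (length As) ⟩
        s * L ^ N * length As              ≤⟨ W-count As ranges′ ⟩
        t * W N (λ τ → count τ As)         ≤⟨ ℕP.*-monoʳ-≤ t (proj₂ attained) ⟩
        t * (L ^ N * count τ As)           ≡⟨ swap′ t (L ^ N) (count τ As) ⟩
        L ^ N * (t * count τ As)           ∎)
      where
      open ℕP.≤-Reasoning
      N = proj₁ (upper-bound height As)
      attained = W-attained N (λ τ → count τ As)
      τ = proj₁ attained
      swap : ∀ p s n → p * (s * n) ≡ s * p * n
      swap = ℕSolver.solve-∀
      swap′ : ∀ t p c → t * (p * c) ≡ p * (t * c)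
      swap′ = ℕSolver.solve-∀
      fit : ∀ {A b} → Below b A → height A ≤ N → Below N A
      fit {[]} _ _ = tt
      fit {_ ∷ _} (_ , rest) x<N = x<N , rest
      ranges′ : LAll.All (InRange N (L * L)) As
      ranges′ = LAll.tabulate λ A∈ → let _ , below , size = LAll.lookup ranges A∈ in
        fit below (proj₂ (upper-bound height As) A∈) , size
      W-count : ∀ Bs → LAll.All (InRange N (L * L)) Bs → s * L ^ N * length Bs ≤ t * W N (λ τ → count τ Bs)
      W-count [] _ = ℕP.≤-trans (ℕP.≤-reflexive (ℕP.*-zeroʳ (s * L ^ N))) z≤n
      W-count (B ∷ Bs) ((below , size) ∷ rest) = begin
        s * L ^ N * suc (length Bs)          ≡⟨ ℕP.*-suc (s * L ^ N) (length Bs) ⟩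
        s * L ^ N + s * L ^ N * length Bs    ≤⟨ ℕP.+-mono-≤ (W-good N B s t large gap below size) (W-count Bs rest) ⟩
        t * W N (λ τ → indicator (good τ K B)) + t * W N (λ τ → count τ Bs) ≡⟨ ℕP.*-distribˡ-+ t _ _ ⟨
        t * (W N (λ τ → indicator (good τ K B)) + W N (λ τ → count τ Bs))   ≡⟨ cong (t *_) (W-+ N _ _) ⟨
        t * W N (λ τ → count τ (B ∷ Bs))     ∎

-- The construction

verts : ℕ → ℕ → List Vertex
verts N zero = [] ∷ []
verts N (suc m) = List.concatMap (λ x → List.map (x ∷_) (verts x m)) (List.upTo N)

∈-verts⁺ : ∀ {N} m A → InRange N m A → A ∈ verts N m
∈-verts⁺ zero [] _ = here refl
∈-verts⁺ (suc m) (x ∷ xs) ((x<N , below) , size) =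
  ∈-concat⁺′ (∈-map⁺ (x ∷_) (∈-verts⁺ m xs (below , ℕP.suc-injective size))) (∈-map⁺ _ (∈-upTo⁺ x<N))

∈-verts⁻ : ∀ {N} m {A} → A ∈ verts N m → InRange N m A
∈-verts⁻ zero (here refl) = tt , refl
∈-verts⁻ {N} (suc m) A∈
  with _ , A∈′ , l∈ ← ∈-concat⁻′ (List.map (λ x → List.map (x ∷_) (verts x m)) (List.upTo N)) A∈
  with x , x∈ , refl ← ∈-map⁻ _ l∈
  with xs , xs∈ , refl ← ∈-map⁻ (x ∷_) A∈′ =
  let below , size = ∈-verts⁻ m xs∈ in (∈-upTo⁻ x∈ , below) , cong suc size

module Construction {d K : ℕ} (F : Fin (suc K) → Point d) (F-inj : ∀ {i j} → F i ≡ F j → i ≡ j)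
  (3≤k : 3 ≤ suc K) (s t : ℕ) (gap : s * suc K + suc t ≤ t * suc K) where

  k = suc K
  -- This choice ensures 2 * t * k ≤ L, as `many-good` requires.
  l = 2 * t * k

  open Cyclic K
  open Count l hiding (k)
  open Similarity F

  _≟V_ : (A B : Vertex) → Dec (A ≡ B)
  _≟V_ = ListP.≡-dec ℕP._≟_

  open Pictures F F-inj 3≤k Vertex _≟V_ Edge Edge-cong Edge-distinct
  open Faithful

  Valid : Vertex → Set
  Valid A = ∃ λ N → InRange N (L * L) A

  copy : Vec Vertex k → Fin k → Point d × Vertex
  copy As i = F i , Vec.lookup As i

  copy-picture : Vec Vertex k → Picture
  copy-picture As = List.map (copy As) (List.allFin k)

  -- A nondegenerate similar copy inside a set of k points uses each of them once, so its labels are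
  -- the windows in some order.
  copy-faithful : ∀ As → Path As → Faithful (copy-picture As)
  copy-faithful As path = record { label-unique = unique ; copies-project = project }
    where
    unique : ∀ {p p′} → p ∈ copy-picture As → p′ ∈ copy-picture As → proj₁ p ≡ proj₁ p′ → proj₂ p ≡ proj₂ p′
    unique p∈ p′∈ eq with i , _ , refl ← ∈-map⁻ (copy As) p∈ | j , _ , refl ← ∈-map⁻ (copy As) p′∈ =
      cong (Vec.lookup As) (F-inj eq)
    project : (φ : Fin k → Point d × Vertex) → (∀ i → φ i ∈ copy-picture As) → Sim (proj₁ ∘ φ) →
      (∀ i j → proj₁ (φ i) ≡ proj₁ (φ j)) ⊎ Edge (proj₂ ∘ φ)
    project φ φ∈ sim with Sim-dichotomy sim
    ... | inj₁ same = inj₁ same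
    ... | inj₂ distinct = inj₂ (As , path , σ , σ-inj , λ i → cong proj₂ (φ≡ i))
      where
      source : ∀ i → ∃ λ j → j ∈ List.allFin k × φ i ≡ copy As j
      source i = ∈-map⁻ (copy As) (φ∈ i)
      σ : Fin k → Fin k
      σ i = proj₁ (source i)
      φ≡ : ∀ i → φ i ≡ copy As (σ i)
      φ≡ i = proj₂ (proj₂ (source i))
      σ-inj : ∀ {i j} → σ i ≡ σ j → i ≡ j
      σ-inj {i} {j} eq with i FinP.≟ j
      ... | yes i≡j = i≡j
      ... | no i≢j = contradiction
        (trans (cong proj₁ (φ≡ i)) (trans (cong F eq) (sym (cong proj₁ (φ≡ j))))) (distinct i≢j)

  []-faithful : Faithful []
  []-faithful = record { label-unique = λ () ; copies-project = λ φ φ∈ → contradiction (φ∈ i₀) λ () }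

  record Copies (Es : List (Vec Vertex k)) : Set where
    field
      picture : Picture
      faithful : Faithful picture
      valid : ∀ {p} → p ∈ picture → Valid (proj₂ p)
      has-copy : ∀ {As} → As ∈ Es → Σ (Homothety d) λ h → ∀ i → move h (copy As i) ∈ picture

  copies : ∀ Es → LAll.All (λ As → Path As × VAll.All Valid As) Es → Copies Es
  copies [] [] = record { picture = [] ; faithful = []-faithful ; valid = λ () ; has-copy = λ () }
  copies (As ∷ Es) ((path , valids) ∷ rest) = record
    { picture = U.union ; faithful = U.faithful ; valid = valid′ ; has-copy = has-copy′ }
    where
    open Copies (copies Es rest)
    module U = Union (disjoint-union picture (copy-picture As) faithful (copy-faithful As path))
    valid′ : ∀ {p} → p ∈ U.union → Valid (proj₂ p)
    valid′ p∈ with U.origin-of p∈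
    ... | inj₁ p∈₁ = valid p∈₁
    ... | inj₂ (_ , q , q∈ , eq) with i , _ , refl ← ∈-map⁻ (copy As) q∈ = subst Valid (sym eq) (VAllP.lookup⁺ valids i)
    has-copy′ : ∀ {Bs} → Bs ∈ As ∷ Es → Σ (Homothety d) λ h → ∀ i → move h (copy Bs i) ∈ U.union
    has-copy′ (here refl) = U.embed , λ i → U.right (∈-map⁺ (copy As) (∈-allFin i))
    has-copy′ (there Bs∈) = let h , e = has-copy Bs∈ in h , λ i → U.left (e i)

  record Stage (r : ℕ) : Set where
    field
      picture : Picture
      faithful : Faithful picture
      valid : ∀ {p} → p ∈ picture → Valid (proj₂ p)
      mono-copy : (c : Point d × Vertex → Fin (suc r)) → Σ (Homothety d) λ h → Σ (Fin k → Vertex) λ f →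
        (∀ i → move h (F i , f i) ∈ picture) × Σ (Fin (suc r)) λ κ → ∀ i → c (move h (F i , f i)) ≡ κ

  -- On an embedded copy of C the colouring becomes a colouring γ of vertices. An edge monochromatic
  -- under γ exists, and its copy of F is then monochromatic.
  build-stage : ∀ r → Stage r
  build-stage r = record { picture = P.picture ; faithful = P.faithful ; valid = valid′ ; mono-copy = mono-copy′ }
    where
    -- The first argument is the predecessor of L * L.
    ramsey = path-ramsey (l + l * L) (suc r) K
    N = proj₁ ramsey
    Es = List.filter path? (words (verts N (L * L)) k)
    edges-valid : LAll.All (λ As → Path As × VAll.All Valid As) Es
    edges-valid = LAll.tabulate λ As∈ →
      let w∈ , path = ∈-filter⁻ path? {xs = words (verts N (L * L)) k} As∈
      in path , VAll.map (λ A∈ → N , ∈-verts⁻ (L * L) A∈) (∈-words⁻ w∈)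
    module C = Copies (copies Es edges-valid)
    module P = Partite (partite C.faithful (List.map proj₂ C.picture) r)
    valid′ : ∀ {p} → p ∈ P.picture → Valid (proj₂ p)
    valid′ p∈ = let q , q∈ , eq = P.labels p∈ in subst Valid (sym eq) (C.valid q∈)
    mono-copy′ : (c : Point d × Vertex → Fin (suc r)) → Σ (Homothety d) λ h → Σ (Fin k → Vertex) λ f →
        (∀ i → move h (F i , f i) ∈ P.picture) × Σ (Fin (suc r)) λ κ → ∀ i → c (move h (F i , f i)) ≡ κ
    mono-copy′ c
      with g , g-embeds , γ , coloured ← P.label-coloured c
      with As , path , ranges , κ , mono ← proj₂ ramsey γ
      with h , in-C ← C.has-copy (∈-filter⁺ path? (∈-words⁺ (VAll.map (∈-verts⁺ (L * L) _) ranges)) path) =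
      g ∘ₕ h , Vec.lookup As , (λ i → subst (_∈ P.picture) (sym (moved i)) (g-embeds (in-C i))) , κ ,
      λ i → trans (cong c (moved i)) (trans (coloured (in-C i) (∈-map⁺ proj₂ (in-C i))) (VAllP.lookup⁺ mono i))
      where
      moved : ∀ i → move (g ∘ₕ h) (copy As i) ≡ move g (move h (copy As i))
      moved i = cong (_, Vec.lookup As i) (apply-∘ₕ g h (F i))

  abstract
    stage : ∀ r → Stage r
    stage = build-stage

  -- Level r + 1 takes in a homothetic image of `stage r`, which handles r + 1 colours. As levels
  -- are nested, finitely many points of their union lie in one faithful picture.
  tower : ℕ → Σ Picture Faithful
  step : ∀ r → Union (proj₁ (tower r)) (Stage.picture (stage r))
  tower zero = [] , []-faithful
  tower (suc r) = Union.union (step r) , Union.faithful (step r)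
  step r = disjoint-union (proj₁ (tower r)) (Stage.picture (stage r)) (proj₂ (tower r)) (Stage.faithful (stage r))

  level : ℕ → Picture
  level r = proj₁ (tower r)

  level-mono : ∀ {r r′ p} → r ≤ r′ → p ∈ level r → p ∈ level r′
  level-mono {r} {r′} r≤r′ p∈ = go (ℕP.≤⇒≤′ r≤r′)
    where
    go : ∀ {r′} → r ℕ.≤′ r′ → _ ∈ level r′
    go ℕ.≤′-refl = p∈
    go (ℕ.≤′-step {n} le) = Union.left (step n) (go le)

  -- The tower starts empty, so every point entered on the right of some union, where coordinates
  -- are nonnegative.
  level-valid : ∀ r {p} → p ∈ level r → VAll.All (+ 0 ℤ.≤_) (proj₁ p) × Valid (proj₂ p)
  level-valid (suc r) p∈ with Union.origin-of (step r) p∈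
  ... | inj₁ p∈₁ = level-valid r p∈₁
  ... | inj₂ (nonneg , q , q∈ , eq) = nonneg , subst Valid (sym eq) (Stage.valid (stage r) q∈)

  X : Point d → Set
  X x = Σ ℕ λ r → Σ Vertex λ v → (x , v) ∈ level r

  X-nonneg : InNat X
  X-nonneg x (r , v , x∈) = proj₁ (level-valid r x∈)

  _∈?_ : (p : Point d × Vertex) (P : Picture) → Dec (p ∈ P)
  _∈?_ = DecMembership._∈?_ (ProductP.≡-dec (VecP.≡-dec ℤP._≟_) _≟V_)

  -- A `Colouring` may depend on the membership proof. Deciding membership selects one proof per
  -- point, at which the colour is read off.
  extend-colouring : ∀ {r} (P : Picture) (c : ∀ p → p ∈ P → Fin (suc r)) →
    Σ (Point d × Vertex → Fin (suc r)) λ c′ → ∀ {p} → p ∈ P → Σ (p ∈ P) λ p∈ → c p p∈ ≡ c′ p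
  extend-colouring {r} P c = c′ , agree
    where
    c′ : Point d × Vertex → Fin (suc r)
    c′ p with p ∈? P
    ... | yes p∈ = c p p∈
    ... | no _ = zero
    agree : ∀ {p} → p ∈ P → Σ (p ∈ P) λ p∈ → c p p∈ ≡ c′ p
    agree {p} p∈ with p ∈? P
    ... | yes p∈′ = p∈′ , refl
    ... | no p∉ = contradiction p∈ p∉

  X-ramsey : (r : ℕ) → 1 ≤ r → (c : Colouring X r) → MonoHomothetic (F , F-inj) X c
  X-ramsey (suc r) _ c =
    shift h , ratio h , ratio≥1 h , (λ i → proj₁ (lift (member i))) , κ , λ i → trans (proj₂ (lift (member i))) (colour i)
    where
    open Homothety
    open Stage (stage r) using (mono-copy)
    extension = extend-colouring (level (suc r)) (λ { (x , v) x∈ → c x (suc r , v , x∈) })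
    extended : Point d × Vertex → Fin (suc r)
    extended = proj₁ extension
    lift : ∀ {x v} → (x , v) ∈ level (suc r) → Σ (X x) λ mem → c x mem ≡ extended (x , v)
    lift {x} {v} x∈ = let x∈′ , eq = proj₂ extension x∈ in (suc r , v , x∈′) , eq
    e = Union.embed (step r)
    found = mono-copy (extended ∘ move e)
    h = e ∘ₕ proj₁ found
    f = proj₁ (proj₂ found)
    κ = proj₁ (proj₂ (proj₂ (proj₂ found)))
    moved : ∀ i → move h (F i , f i) ≡ move e (move (proj₁ found) (F i , f i))
    moved i = cong (_, f i) (apply-∘ₕ e (proj₁ found) (F i))
    member : ∀ i → move h (F i , f i) ∈ level (suc r)
    member i = subst (_∈ level (suc r)) (sym (moved i)) (Union.right (step r) (proj₁ (proj₂ (proj₂ found)) i))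
    colour : ∀ i → extended (move h (F i , f i)) ≡ κ
    colour i = trans (cong extended (moved i)) (proj₂ (proj₂ (proj₂ (proj₂ found))) i)

  -- Large F-free subsets.

  congruent⇒Sim : ∀ (φ : Fin k → Point d) {p q} → 1 ≤ q →
    (∀ i j → (+ q) ℤ.* dist² (φ i) (φ j) ≡ (+ p) ℤ.* dist² (F i) (F j)) → Sim φ
  congruent⇒Sim φ {p} {suc q} _ eq i j i′ j′ = ℤP.*-cancelˡ-≡ (+ suc q) _ _ (begin
    Q ℤ.* (S ℤ.* D′)     ≡⟨ ℤP.*-assoc Q S D′ ⟨
    Q ℤ.* S ℤ.* D′       ≡⟨ cong (ℤ._* D′) (eq i j) ⟩
    + p ℤ.* D ℤ.* D′     ≡⟨ ℤP.*-assoc (+ p) D D′ ⟩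
    + p ℤ.* (D ℤ.* D′)   ≡⟨ cong (+ p ℤ.*_) (ℤP.*-comm D D′) ⟩
    + p ℤ.* (D′ ℤ.* D)   ≡⟨ ℤP.*-assoc (+ p) D′ D ⟨
    + p ℤ.* D′ ℤ.* D     ≡⟨ cong (ℤ._* D) (eq i′ j′) ⟨
    Q ℤ.* S′ ℤ.* D       ≡⟨ ℤP.*-assoc Q S′ D ⟩
    Q ℤ.* (S′ ℤ.* D)     ∎)
    where
    open ≡-Reasoning
    Q = + suc q
    S = dist² (φ i) (φ j)
    S′ = dist² (φ i′) (φ j′)
    D = dist² (F i) (F j)
    D′ = dist² (F i′) (F j′)

  congruent-nonconstant : ∀ (φ : Fin k → Point d) {p q} → 1 ≤ p →
    (∀ i j → (+ q) ℤ.* dist² (φ i) (φ j) ≡ (+ p) ℤ.* dist² (F i) (F j)) → ¬ (∀ i j → φ i ≡ φ j)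
  congruent-nonconstant φ {suc p} {q} _ eq same
    with ℤP.i*j≡0⇒i≡0∨j≡0 (+ suc p) (trans (sym (eq i₁ i₀))
           (trans (cong (+ q ℤ.*_) (trans (cong (dist² (φ i₁)) (same i₀ i₁)) (dist²-self (φ i₁)))) (ℤP.*-zeroʳ (+ q))))
  ... | inj₂ D≡0 = F-dist≢0 i₁≢i₀ D≡0

  module _ (τ : Marking) where

    good? : (p : Point d × Vertex) → Dec (Good τ K (proj₂ p))
    good? p = good τ K (proj₂ p) BoolP.≟ true

    -- The points of a congruent copy of a dilate lie in one level and are not all equal, so their
    -- labels would form an edge of good vertices.
    good-free : (Y : List (Point d × Vertex)) → LAll.All (λ p → ∃ λ r → p ∈ level r) Y →
      FFree (F , F-inj) (List.map proj₁ (List.filter good? Y))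
    good-free Y levels (φ , φ∈ , p , q , 1≤p , 1≤q , eq) = absurd (copies-project (proj₂ (tower R)) y y∈level
        (Sim-cong φ≡ (congruent⇒Sim φ {p} {q} 1≤q eq)))
      where
      source : ∀ i → ∃ λ z → z ∈ List.filter good? Y × φ i ≡ proj₁ z
      source i = ∈-map⁻ proj₁ (φ∈ i)
      y : Fin k → Point d × Vertex
      y i = proj₁ (source i)
      φ≡ : ∀ i → φ i ≡ proj₁ (y i)
      φ≡ i = proj₂ (proj₂ (source i))
      y∈ : ∀ i → y i ∈ Y × Good τ K (proj₂ (y i))
      y∈ i = ∈-filter⁻ good? {xs = Y} (proj₁ (proj₂ (source i)))
      lev : ∀ i → ∃ λ r → y i ∈ level r
      lev i = LAll.lookup levels (proj₁ (y∈ i))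
      bound = upper-bound (proj₁ ∘ lev) (List.allFin k)
      R = proj₁ bound
      y∈level : ∀ i → y i ∈ level R
      y∈level i = level-mono (proj₂ bound (∈-allFin i)) (proj₂ (lev i))
      absurd : ¬ ((∀ i j → proj₁ (y i) ≡ proj₁ (y j)) ⊎ Edge (proj₂ ∘ y))
      absurd (inj₁ same) = congruent-nonconstant φ {p} {q} 1≤p eq
        (λ i j → trans (φ≡ i) (trans (same i j) (sym (φ≡ j))))
      absurd (inj₂ edge) = Edge-not-good τ edge (proj₂ ∘ y∈)

    filter-length : (Y : List (Point d × Vertex)) → length (List.filter good? Y) ≡ count τ (List.map proj₂ Y)
    filter-length [] = refl
    filter-length (p ∷ Y) with good τ K (proj₂ p)
    ... | true = cong suc (filter-length Y)
    ... | false = filter-length Y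

  labelled : (Y : List (Point d)) → (∀ {x} → x ∈ Y → X x) →
    Σ (List (Point d × Vertex)) λ Y′ → List.map proj₁ Y′ ≡ Y × LAll.All (λ p → ∃ λ r → p ∈ level r) Y′
  labelled [] _ = [] , refl , []
  labelled (x ∷ Y) inX with r , v , x∈ ← inX (here refl) | Y′ , eq , levels ← labelled Y (λ x∈ → inX (there x∈)) =
    (x , v) ∷ Y′ , cong (x ∷_) eq , (r , x∈) ∷ levels

  X-free : (Y : List (Point d)) → FiniteSubsetOf Y X →
    Σ (List (Point d)) λ Z → Unique Z × Z ⊆ˡ Y × FFree (F , F-inj) Z × s * length Y ≤ t * length Z
  X-free Y (uniq , inX) with Y′ , refl , levels ← labelled Y inX
    with τ , many ← many-good s t (ℕP.n≤1+n l) gap (List.map proj₂ Y′)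
      (LAllP.map⁺ (LAll.map (λ { (r , p∈) → proj₂ (level-valid r p∈) }) levels)) =
    List.map proj₁ (List.filter (good? τ) Y′) ,
    AllPairsP.map⁺ (AllPairsP.filter⁺ (good? τ) (AllPairsP.map⁻ uniq)) ,
    sub ,
    good-free τ Y′ levels ,
    subst₂ (λ a b → s * a ≤ t * b)
      (trans (ListP.length-map proj₂ Y′) (sym (ListP.length-map proj₁ Y′)))
      (trans (sym (filter-length τ Y′)) (sym (ListP.length-map proj₁ (List.filter (good? τ) Y′)))) many
    where
    sub : List.map proj₁ (List.filter (good? τ) Y′) ⊆ˡ List.map proj₁ Y′
    sub x∈ with p , p∈ , refl ← ∈-map⁻ proj₁ x∈ = ∈-map⁺ proj₁ (proj₁ (∈-filter⁻ (good? τ) {xs = Y′} p∈))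

theorem1p5 : (d k : ℕ) → 3 ℕ.≤ k → (F : Config d k) → (μ : ℚ) →
    ℚ.0ℚ ℚ.< μ → μ ℚ.< predOver k →
    Σ (Point d → Set) λ X → InNat X ×
    ((r : ℕ) → 1 ℕ.≤ r → (c : Colouring X r) → MonoHomothetic F X c) ×
    ((Y : List (Point d)) → FiniteSubsetOf Y X →
    Σ (List (Point d)) λ Z → Unique Z × Z ⊆ˡ Y × FFree F Z ×
    μ ℚ.* ℕtoℚ (length Y) ℚ.≤ ℕtoℚ (length Z))
theorem1p5 d (suc K) 3≤k (F , F-inj) (ℚ.mkℚ (ℤ.-[1+ _ ]) _ _) (ℚ.*<* ()) _
theorem1p5 d (suc K) 3≤k (F , F-inj) μ@(ℚ.mkℚ (+ s) t-1 _) _ μ<k-1/k =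
  X , X-nonneg , X-ramsey , λ Y Y⊆X → let Z , uniq , sub , free , large = X-free Y Y⊆X in
    Z , uniq , sub , free , density (length Y) (length Z) large
  where
  t = suc t-1
  -- `predOver` is reduced to lowest terms; the unreduced fraction K / suc K yields the cross
  -- products.
  sk<Kt : s * suc K < K * t
  sk<Kt with ℚᵘP.<-respʳ-≃ (ℚP.toℚᵘ-fromℚᵘ (mkℚᵘ (+ K) K)) (ℚP.toℚᵘ-mono-< μ<k-1/k)
  ... | ℚᵘ.*<* lt = ℤP.drop‿+<+ (subst₂ ℤ._<_ (sym (ℤP.pos-* s (suc K))) (sym (ℤP.pos-* K t)) lt)
  -- Strictness between naturals supplies the extra unit, which leaves room for the error term.
  gap : s * suc K + suc t ≤ t * suc K
  gap = ℕP.≤-trans (ℕP.≤-reflexive (ℕP.+-suc (s * suc K) t)) (ℕP.≤-trans (ℕP.+-monoˡ-≤ t sk<Kt)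
    (ℕP.≤-reflexive (lemma K t)))
    where
    lemma : ∀ K t → K * t + t ≡ t * suc K
    lemma = ℕSolver.solve-∀
  open Construction F F-inj 3≤k s t gap
  density : ∀ y z → s * y ≤ t * z → μ ℚ.* ℕtoℚ y ℚ.≤ ℕtoℚ z
  density y z sy≤tz = ℚP.toℚᵘ-cancel-≤ (begin
    ℚ.toℚᵘ (μ ℚ.* ℕtoℚ y)              ≃⟨ ℚP.toℚᵘ-homo-* μ (ℕtoℚ y) ⟩
    ℚ.toℚᵘ μ ℚᵘ.* ℚ.toℚᵘ (ℕtoℚ y)      ≃⟨ ℚᵘP.*-congˡ {ℚ.toℚᵘ μ} (ℚP.toℚᵘ-fromℚᵘ (mkℚᵘ (+ y) 0)) ⟩
    ℚ.toℚᵘ μ ℚᵘ.* mkℚᵘ (+ y) 0         ≤⟨ ℚᵘ.*≤* integers ⟩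
    mkℚᵘ (+ z) 0                       ≃⟨ ℚP.toℚᵘ-fromℚᵘ (mkℚᵘ (+ z) 0) ⟨
    ℚ.toℚᵘ (ℕtoℚ z)                    ∎)
    where
    open ℚᵘP.≤-Reasoning
    integers : (+ s ℤ.* + y) ℤ.* + 1 ℤ.≤ + z ℤ.* (+ (t * 1))
    integers = subst₂ ℤ._≤_
      (trans (ℤP.pos-* s y) (sym (ℤP.*-identityʳ (+ s ℤ.* + y))))
      (trans (cong +_ (trans (ℕP.*-comm t z) (cong (z *_) (sym (ℕP.*-identityʳ t))))) (ℤP.pos-* z (t * 1)))
      (ℤ.+≤+ sy≤tz)
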